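{- For every integer $N\ge5$, \[ h(N)>\left\lfloor\frac{\lfloor\sqrt{N}\rfloor+1}{2}\right\rfloor. \]
   Context: A finite set $A\subseteq\mathbb{Z}$ is Sidon if $a+b=c+d$ with $a,b,c,d\in A$ implies $\{a,b\}=\{c,d\}$ as unordered pairs. For a natural number $N$, $h(N)=\max\{|A| : A\subseteq\{1,\dots,N\},\ A\text{ Sidon}\}$. -}

module Defs where

open import Data.Empty using (⊥-elim)
open import Data.Integer.Base as ℤ using (ℤ; +_)
import Data.Integer.Properties as ℤ
open import Data.List.Base using (List; []; _∷_; _++_; map; filter; length; applyUpTo)
open import Data.List.Extrema.Nat using (max; xs≤max; argmax-sel)
open import Data.List.Membership.DecPropositional ℤ._≟_ using (_∈?_)
open import Data.List.Membership.Propositional using (_∈_)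
open import Data.List.Membership.Propositional.Properties
open import Data.List.Properties using (length-++)
open import Data.List.Relation.Binary.Subset.Propositional using (_⊆_)
open import Data.List.Relation.Unary.All as All using (All; []; _∷_; all?)
open import Data.List.Relation.Unary.AllPairs using ([]; _∷_)
open import Data.List.Relation.Unary.Any using (here; there)
open import Data.List.Relation.Unary.Unique.Propositional using (Unique)
open import Data.List.Relation.Unary.Unique.Propositional.Properties using (applyUpTo⁺₁)
open import Data.Nat.Base using (ℕ; zero; suc; _+_; _*_; _≤_; _<_; z≤n; s≤s)
open import Data.Nat.Properties
open import Data.Product using (∃; _×_; _,_; proj₁; proj₂)
open import Data.Sum using (_⊎_; inj₁; inj₂)
open import Function using (id)
open import Relation.Binary.PropositionalEquality
open import Relation.Nullary using (Dec; yes; no)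
open import Relation.Nullary.Decidable using (map′; _×-dec_; _⊎-dec_; _→-dec_)

-- A finite set of integers is encoded as a list; `Unique` is required wherever
-- its length is read as a cardinality.

Sidon : List ℤ → Set
Sidon A = ∀ {a b c d} → a ∈ A → b ∈ A → c ∈ A → d ∈ A →
          a ℤ.+ b ≡ c ℤ.+ d → (a ≡ c × b ≡ d) ⊎ (a ≡ d × b ≡ c)

sidon? : ∀ A → Dec (Sidon A)
sidon? A = map′
  (λ p a b c d → All.lookup (All.lookup (All.lookup (All.lookup p a) b) c) d)
  (λ s → All.tabulate λ a → All.tabulate λ b → All.tabulate λ c → All.tabulate λ d → s a b c d)
  (all? (λ a → all? (λ b → all? (λ c → all? (λ d →
     (a ℤ.+ b ℤ.≟ c ℤ.+ d) →-dec
     (((a ℤ.≟ c) ×-dec (b ℤ.≟ d)) ⊎-dec ((a ℤ.≟ d) ×-dec (b ℤ.≟ c)))) A) A) A) A)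

-- {1, …, N}
interval : ℕ → List ℤ
interval N = applyUpTo (λ i → + suc i) N

powerset : ∀ {a} {X : Set a} → List X → List (List X)
powerset []       = [] ∷ []
powerset (x ∷ xs) = powerset xs ++ map (x ∷_) (powerset xs)

sidonSubsets : ℕ → List (List ℤ)
sidonSubsets N = filter sidon? (powerset (interval N))

-- The default 0 of `max` is the size of the empty Sidon set; `h-attained` and
-- `h-upper` below state that h N is the maximum over all Sidon A ⊆ {1, …, N}.
h : ℕ → ℕ
h N = max 0 (map length (sidonSubsets N))

-- The floor of the square root, characterised by `√-lower` and `√-upper`.
⌊√_⌋ : ℕ → ℕ
⌊√ zero ⌋  = 0
⌊√ suc n ⌋ with suc ⌊√ n ⌋ * suc ⌊√ n ⌋ ≤? suc n
... | yes _ = suc ⌊√ n ⌋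
... | no  _ = ⌊√ n ⌋

√-lower : ∀ n → ⌊√ n ⌋ * ⌊√ n ⌋ ≤ n
√-lower zero = z≤n
√-lower (suc n) with suc ⌊√ n ⌋ * suc ⌊√ n ⌋ ≤? suc n
... | yes p = p
... | no  _ = m≤n⇒m≤1+n (√-lower n)

√-upper : ∀ n → n < suc ⌊√ n ⌋ * suc ⌊√ n ⌋
√-upper zero = s≤s z≤n
√-upper (suc n) with suc ⌊√ n ⌋ * suc ⌊√ n ⌋ ≤? suc n
... | yes _ = ≤-<-trans (√-upper n) (*-mono-< (n<1+n (suc ⌊√ n ⌋)) (n<1+n (suc ⌊√ n ⌋)))
... | no ¬p = ≰⇒> ¬p

private
  ∈-interval⁺ : ∀ {N z} → + 1 ℤ.≤ z → z ℤ.≤ + N → z ∈ interval N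
  ∈-interval⁺ {z = + suc i} _ (ℤ.+≤+ p) = ∈-applyUpTo⁺ (λ j → + suc j) p
  ∈-interval⁺ {z = + zero} (ℤ.+≤+ ()) _

  ∈-interval⁻ : ∀ {N z} → z ∈ interval N → + 1 ℤ.≤ z × z ℤ.≤ + N
  ∈-interval⁻ z∈ with ∈-applyUpTo⁻ (λ j → + suc j) z∈
  ... | i , i<N , refl = ℤ.+≤+ (s≤s z≤n) , ℤ.+≤+ i<N

  interval-unique : ∀ N → Unique (interval N)
  interval-unique N = applyUpTo⁺₁ (λ j → + suc j) N
    λ i<j _ eq → <⇒≢ i<j (suc-injective (ℤ.+-injective eq))

  powerset-⊆ : ∀ {xs ys : List ℤ} → ys ∈ powerset xs → ys ⊆ xs
  powerset-⊆ {[]} (here refl) ()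
  powerset-⊆ {x ∷ xs} p with ∈-++⁻ (powerset xs) p
  ... | inj₁ q = λ z → there (powerset-⊆ q z)
  ... | inj₂ q with ∈-map⁻ (x ∷_) q
  ...   | ys , r , refl = λ { (here e) → here e ; (there z) → there (powerset-⊆ r z) }

  powerset-unique : ∀ {xs ys : List ℤ} → Unique xs → ys ∈ powerset xs → Unique ys
  powerset-unique {[]} _ (here refl) = []
  powerset-unique {x ∷ xs} (x∉ ∷ u) p with ∈-++⁻ (powerset xs) p
  ... | inj₁ q = powerset-unique u q
  ... | inj₂ q with ∈-map⁻ (x ∷_) q
  ...   | ys , r , refl =
    All.tabulate (λ z → All.lookup x∉ (powerset-⊆ r z)) ∷ powerset-unique u r

  filter-∈-powerset : ∀ (A xs : List ℤ) → filter (_∈? A) xs ∈ powerset xs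
  filter-∈-powerset A [] = here refl
  filter-∈-powerset A (x ∷ xs) with x ∈? A
  ... | yes _ = ∈-++⁺ʳ (powerset xs) (∈-map⁺ (x ∷_) (filter-∈-powerset A xs))
  ... | no  _ = ∈-++⁺ˡ (filter-∈-powerset A xs)

  length-⊆ : ∀ {xs ys : List ℤ} → Unique xs → xs ⊆ ys → length xs ≤ length ys
  length-⊆ {[]} _ _ = z≤n
  length-⊆ {x ∷ xs} (x∉ ∷ u) sub with ∈-∃++ (sub (here refl))
  ... | ps , qs , refl = begin
      suc (length xs)                ≤⟨ s≤s (length-⊆ u sub′) ⟩
      suc (length (ps ++ qs))        ≡⟨ cong suc (length-++ ps) ⟩
      suc (length ps + length qs)    ≡⟨ +-suc (length ps) (length qs) ⟨
      length ps + suc (length qs)    ≡⟨ length-++ ps ⟨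
      length (ps ++ x ∷ qs)          ∎
    where
    open ≤-Reasoning
    sub′ : xs ⊆ ps ++ qs
    sub′ z with ∈-++⁻ ps (sub (there z))
    ... | inj₁ p           = ∈-++⁺ˡ p
    ... | inj₂ (here refl) = ⊥-elim (All.lookup x∉ z refl)
    ... | inj₂ (there q)   = ∈-++⁺ʳ ps q

SidonIn : ℕ → List ℤ → Set
SidonIn N A = Unique A × All (λ a → + 1 ℤ.≤ a × a ℤ.≤ + N) A × Sidon A

h-attained : ∀ N → ∃ λ A → SidonIn N A × length A ≡ h N
h-attained N with argmax-sel id 0 (map length (sidonSubsets N))
... | inj₁ eq = [] , ([] , [] , λ ()) , sym eq
... | inj₂ m∈ with ∈-map⁻ length m∈
...   | A , A∈ , eq with ∈-filter⁻ sidon? {xs = powerset (interval N)} A∈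
...     | A∈P , s = A
        , ( powerset-unique (interval-unique N) A∈P
          , All.tabulate (λ z → ∈-interval⁻ (powerset-⊆ A∈P z))
          , λ {a} {b} {c} {d} → s {a} {b} {c} {d})
        , sym eq

h-upper : ∀ N A → SidonIn N A → length A ≤ h N
h-upper N A (u , r , s) = ≤-trans (length-⊆ u A⊆B)
  (All.lookup (xs≤max 0 (map length (sidonSubsets N)))
    (∈-map⁺ length (∈-filter⁺ sidon? (filter-∈-powerset A (interval N)) sB)))
  where
  B : List ℤ
  B = filter (_∈? A) (interval N)
  A⊆B : A ⊆ B
  A⊆B z = ∈-filter⁺ (_∈? A) (∈-interval⁺ (proj₁ (All.lookup r z)) (proj₂ (All.lookup r z))) z
  B⊆A : B ⊆ A
  B⊆A z = proj₂ (∈-filter⁻ (_∈? A) {xs = interval N} z)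
  sB : Sidon B
  sB a b c d = s (B⊆A a) (B⊆A b) (B⊆A c) (B⊆A d)

{-# OPTIONS --safe #-}
module Submission where

-- For a prime p with primitive root g, Ruzsa's set of the solutions x of
-- x ≡ i (mod p - 1), x ≡ gⁱ (mod p), one for each i < p - 1, is Sidon modulo
-- p (p - 1): the sum of two elements determines both gⁱ + gʲ and gⁱ gʲ modulo p.
-- Hence h N ≥ p - 1 once p (p - 1) ≤ N. With m = ⌊(⌊√N⌋ + 1) / 2⌋ it remains
-- to find a prime m + 1 < p < 2 m, which for m ≥ 3 is given by Erdős's proof of
-- Bertrand's postulate; the set {1, 2, 4} settles m ≤ 2.

open import Defs
open import Algebra.Properties.AbelianGroup using (∙-cancelˡ)
open import Data.Empty using (⊥)
open import Data.Integer.Base as ℤ using (ℤ)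
import Data.Integer.Properties as ℤ
open import Data.List.Base using (List; []; _∷_; applyUpTo)
open import Data.List.Membership.Propositional.Properties using (∈-applyUpTo⁻)
open import Data.List.Properties using (length-applyUpTo)
open import Data.List.Relation.Unary.All as All using (All; all?)
import Data.List.Relation.Unary.All.Properties as AllP
open import Data.List.Relation.Unary.AllPairs using (allPairs?)
open import Data.List.Relation.Unary.Unique.Propositional using (Unique)
import Data.List.Relation.Unary.Unique.Propositional.Properties as UniqueP
open import Data.Nat
open import Data.Nat.Combinatorics using (_C_; nCn≡1; nCk≡nC[n∸k]; nCk+nC[k+1]≡[n+1]C[k+1]; k>n⇒nCk≡0)
open import Data.Nat.Coprimality as Coprime using (Coprime)
open import Data.Nat.Divisibility
open import Data.Nat.DivMod
open import Data.Nat.GCD using (gcd; gcd-GCD; gcd[m,n]∣m; gcd[m,n]∣n; module Bézout)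
open import Data.Nat.Induction using (<-rec)
open import Data.Nat.LCM using (lcm; lcm-least; m∣lcm[m,n]; n∣lcm[m,n])
open import Data.Nat.Primality
open import Data.Nat.Properties
open import Data.Nat.Tactic.RingSolver using (solve-∀)
open import Data.Product using (∃; ∃₂; _×_; _,_; proj₁; proj₂)
open import Data.Sum using (_⊎_; inj₁; inj₂; [_,_]′)
open import Data.Vec.Base using (Vec; []; _∷_)
open import Function using (_∘_; _$_; id)
open import Relation.Binary.PropositionalEquality
open import Relation.Nullary using (¬_; yes; no; contradiction)
open import Relation.Nullary.Decidable using (_×-dec_; ¬?; decidable-stable; from-yes; toWitness)

-- Primes and coprimality

-- Each end of the interval for p has its purpose: p > m + 1 makes p - 1 exceed m, and p < 2 m ≤
-- ⌊√N⌋ + 1 gives p ≤ ⌊√N⌋, so that p (p - 1) ≤ N. Since n + 1 lies outside the interval (n + 1, 2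
-- n), it may be a prime factor of C(2n, n) in Erdős's argument, where it costs a factor n + 1. All
-- arithmetic stays in ℕ. Modulo p the factor p - 1 acts as -1, and a difference is handled by
-- writing the larger number as a sum. In place of Legendre's formula, C(n, k) divides lcm(1, ...,
-- n), so a prime power dividing C(n, k) is at most n. Logarithms are replaced by an explicit e with
-- ⌊√(2n)⌋ < 2^e. The primitive root is a product of elements whose orders are the prime powers
-- exactly dividing p - 1; these exist because X^t - 1 has at most t roots modulo p.

prime>1 : ∀ {p} → Prime p → 1 < p
prime>1 {p} pr = nonTrivial⇒n>1 p {{prime⇒nonTrivial pr}}

prime∤⇒coprime : ∀ {p n} → Prime p → p ∤ n → Coprime p n
prime∤⇒coprime pr p∤n (d∣p , d∣n) with prime⇒irreducible pr d∣p
... | inj₁ d≡1  = d≡1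
... | inj₂ refl = contradiction d∣n p∤n

^-distribʳ-* : ∀ n a b → (a * b) ^ n ≡ a ^ n * b ^ n
^-distribʳ-* zero    a b = refl
^-distribʳ-* (suc n) a b = trans (cong (a * b *_) (^-distribʳ-* n a b)) (lem a b (a ^ n) (b ^ n))
  where
  lem : ∀ a b c d → a * b * (c * d) ≡ a * c * (b * d)
  lem = solve-∀

coprime-* : ∀ {a b c} → Coprime a c → Coprime b c → Coprime (a * b) c
coprime-* ca cb (d∣ab , d∣c) = cb (Coprime.coprime-divisor coprime-da d∣ab , d∣c)
  where
  coprime-da : Coprime _ _
  coprime-da (e∣d , e∣a) = ca (e∣a , ∣-trans e∣d d∣c)

coprime-^ : ∀ {a c} k → Coprime a c → Coprime (a ^ k) c
coprime-^ zero    _ = Coprime.1-coprimeTo _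
coprime-^ (suc k) c = coprime-* c (coprime-^ k c)

coprime-*-∣ : ∀ {a b n} → Coprime a b → a ∣ n → b ∣ n → a * b ∣ n
coprime-*-∣ {a} {b} c (divides q refl) b∣n =
  subst (a * b ∣_) (*-comm a q) (*-monoʳ-∣ a (Coprime.coprime-divisor (Coprime.sym c) (subst (b ∣_) (*-comm q a) b∣n)))

primeDivisor : ∀ n → 1 < n → ∃ λ q → Prime q × q ∣ n
primeDivisor = <-rec _ go
  where
  go : ∀ n → (∀ {m} → m < n → 1 < m → ∃ λ q → Prime q × q ∣ m) → 1 < n → ∃ λ q → Prime q × q ∣ n
  go n rec 1<n with prime? n
  ... | yes pr = n , pr , ∣-refl
  ... | no ¬pr with ¬prime⇒composite {{n>1⇒nonTrivial 1<n}} ¬pr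
  ...   | composite {d} d<n d∣n with rec d<n (nonTrivial⇒n>1 d)
  ...     | q , pr , q∣d = q , pr , ∣-trans q∣d d∣n

factorOut : ∀ p → 1 < p → ∀ n → 0 < n → ∃₂ λ k m → n ≡ p ^ k * m × p ∤ m
factorOut p 1<p = <-rec _ go
  where
  go : ∀ n → (∀ {m} → m < n → 0 < m → ∃₂ λ k l → m ≡ p ^ k * l × p ∤ l) →
       0 < n → ∃₂ λ k m → n ≡ p ^ k * m × p ∤ m
  go n rec 0<n with p ∣? n
  ... | no p∤n = 0 , n , sym (+-identityʳ n) , p∤n
  go .(zero * p) rec () | yes (divides zero refl)
  go .(suc q * p) rec 0<n | yes (divides (suc q) refl)
    with rec {suc q} (m<m*n (suc q) p 1<p) z<s
  ... | k , m , eq , p∤m = suc k , m , trans (cong (_* p) eq) (lem (p ^ k) m p) , p∤m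
    where
    lem : ∀ a b c → a * b * c ≡ c * a * b
    lem = solve-∀

-- With c d = q^(e+1), either q divides the cofactor c and cancels, or c is coprime to q and hence
-- equal to 1.
∣primePower : ∀ {q} → Prime q → ∀ e {d} → d ∣ q ^ suc e → d ≡ q ^ suc e ⊎ d ∣ q ^ e
∣primePower {q} pr e {d} (divides c eq) with q ∣? c
... | yes (divides c′ refl) = inj₂ (divides c′ (*-cancelˡ-≡ _ _ q {{prime⇒nonZero pr}} (trans eq (lem c′ q d))))
  where
  lem : ∀ a b c → a * b * c ≡ b * (a * c)
  lem = solve-∀
... | no q∤c = inj₁ (sym (trans eq (trans (cong (_* d) c≡1) (*-identityˡ d))))
  where
  c≡1 : c ≡ 1
  c≡1 = coprime-^ (suc e) (prime∤⇒coprime pr q∤c) (divides d (trans eq (*-comm c d)) , ∣-refl)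

-- Binomial coefficients

nC0≡1 : ∀ n → n C 0 ≡ 1
nC0≡1 n = trans (nCk≡nC[n∸k] {0} {n} z≤n) (nCn≡1 n)

absorption : ∀ n k → suc k * (suc n C suc k) ≡ suc n * (n C k)
absorption zero    zero    = refl
absorption zero    (suc k) = trans (cong (suc (suc k) *_) (k>n⇒nCk≡0 {1} {suc (suc k)} (s<s z<s)))
  (trans (*-zeroʳ (suc (suc k))) (sym (cong (1 *_) (k>n⇒nCk≡0 {0} {suc k} z<s))))
absorption (suc n) zero    = begin-equality
  1 * (suc (suc n) C 1)                    ≡⟨ cong (1 *_) (nCk+nC[k+1]≡[n+1]C[k+1] (suc n) 0) ⟨
  1 * ((suc n C 0) + (suc n C 1))          ≡⟨ lem (suc n C 0) (suc n C 1) ⟩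
  (suc n C 0) + 1 * (suc n C 1)            ≡⟨ cong₂ _+_ (nC0≡1 (suc n)) (absorption n 0) ⟩
  1 + suc n * (n C 0)                      ≡⟨ cong (λ z → 1 + suc n * z) (nC0≡1 n) ⟩
  suc (suc n) * 1                          ≡⟨ cong (suc (suc n) *_) (nC0≡1 (suc n)) ⟨
  suc (suc n) * (suc n C 0)                ∎
  where
  open ≤-Reasoning
  lem : ∀ a b → 1 * (a + b) ≡ a + 1 * b
  lem = solve-∀
absorption (suc n) (suc k) = begin-equality
  suc (suc k) * (suc (suc n) C suc (suc k))
    ≡⟨ cong (suc (suc k) *_) (nCk+nC[k+1]≡[n+1]C[k+1] (suc n) (suc k)) ⟨
  suc (suc k) * ((suc n C suc k) + (suc n C suc (suc k)))
    ≡⟨ lem₁ (suc k) (suc n C suc k) (suc n C suc (suc k)) ⟩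
  (suc n C suc k) + (suc k * (suc n C suc k) + suc (suc k) * (suc n C suc (suc k)))
    ≡⟨ cong ((suc n C suc k) +_) (cong₂ _+_ (absorption n k) (absorption n (suc k))) ⟩
  (suc n C suc k) + (suc n * (n C k) + suc n * (n C suc k))
    ≡⟨ cong ((suc n C suc k) +_) (*-distribˡ-+ (suc n) (n C k) (n C suc k)) ⟨
  (suc n C suc k) + suc n * ((n C k) + (n C suc k))
    ≡⟨ cong (λ z → (suc n C suc k) + suc n * z) (nCk+nC[k+1]≡[n+1]C[k+1] n k) ⟩
  suc (suc n) * (suc n C suc k) ∎
  where
  open ≤-Reasoning
  lem₁ : ∀ a b c → (1 + a) * (b + c) ≡ b + (a * b + (1 + a) * c)
  lem₁ = solve-∀

-- By `absorption`, p divides k C(p, k), and it does not divide k.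
prime∣pCk : ∀ {p} → Prime p → ∀ {k} → 0 < k → k < p → p ∣ p C k
prime∣pCk {suc p} pr {suc k} _ k<p =
  [ (λ d → contradiction d (>⇒∤ k<p)) , id ]′
    (euclidsLemma (suc k) _ pr (divides (p C k) (trans (absorption p k) (*-comm (suc p) _))))

-- The sum stops after k terms: Pascal's rule becomes a recursion between partial sums, and
-- `freshman` can discard the terms one at a time.
binomialSum : ℕ → ℕ → ℕ → ℕ
binomialSum x n zero    = 0
binomialSum x n (suc k) = binomialSum x n k + (n C k) * x ^ k

binomialSum-suc : ∀ x n k → binomialSum x (suc n) (suc k) ≡ binomialSum x n (suc k) + x * binomialSum x n k
binomialSum-suc x n zero = trans (cong (λ z → z * 1) (trans (nC0≡1 (suc n)) (sym (nC0≡1 n))))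
  (sym (trans (cong ((n C 0) * 1 +_) (*-zeroʳ x)) (+-identityʳ _)))
binomialSum-suc x n (suc k) = begin-equality
  binomialSum x (suc n) (suc k) + (suc n C suc k) * x ^ suc k
    ≡⟨ cong₂ (λ u v → u + v * x ^ suc k) (binomialSum-suc x n k) (sym (nCk+nC[k+1]≡[n+1]C[k+1] n k)) ⟩
  (binomialSum x n (suc k) + x * binomialSum x n k) + ((n C k) + (n C suc k)) * (x * x ^ k)
    ≡⟨ lem (binomialSum x n (suc k)) x (binomialSum x n k) (n C k) (n C suc k) (x ^ k) ⟩
  (binomialSum x n (suc k) + (n C suc k) * (x * x ^ k)) + x * (binomialSum x n k + (n C k) * x ^ k) ∎
  where
  open ≤-Reasoning
  lem : ∀ s x t a b y → (s + x * t) + (a + b) * (x * y) ≡ (s + b * (x * y)) + x * (t + a * y)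
  lem = solve-∀

binomialTheorem : ∀ x n → binomialSum x n (suc n) ≡ (1 + x) ^ n
binomialTheorem x zero    = refl
binomialTheorem x (suc n) = begin-equality
  binomialSum x (suc n) (suc (suc n))
    ≡⟨ binomialSum-suc x n (suc n) ⟩
  (binomialSum x n (suc n) + (n C suc n) * x ^ suc n) + x * binomialSum x n (suc n)
    ≡⟨ cong (λ z → (binomialSum x n (suc n) + z * x ^ suc n) + x * binomialSum x n (suc n)) (k>n⇒nCk≡0 (n<1+n n)) ⟩
  (binomialSum x n (suc n) + 0) + x * binomialSum x n (suc n)
    ≡⟨ cong (λ z → (z + 0) + x * z) (binomialTheorem x n) ⟩
  ((1 + x) ^ n + 0) + x * (1 + x) ^ n
    ≡⟨ cong (_+ x * (1 + x) ^ n) (+-identityʳ _) ⟩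
  (1 + x) ^ suc n ∎
  where open ≤-Reasoning

-- Polynomials over ℕ modulo a prime

eval : ∀ {n} → Vec ℕ n → ℕ → ℕ
eval []       x = 0
eval (c ∷ cs) x = c + x * eval cs x

-- Synthetic division by X - a: the Horner values of the tails at a are the coefficients of the
-- quotient.
quotientBy : ∀ {n} → ℕ → Vec ℕ (suc n) → Vec ℕ n
quotientBy a (c ∷ [])     = []
quotientBy a (c ∷ d ∷ ds) = eval (d ∷ ds) a ∷ quotientBy a (d ∷ ds)

-- Division with remainder, evaluated at x = a + e so that the difference x - a is the natural
-- number e.
eval-quotientBy : ∀ {n} (f : Vec ℕ (suc n)) a e →
                  eval f (a + e) ≡ eval f a + e * eval (quotientBy a f) (a + e)
eval-quotientBy (c ∷ [])     a e = lem c a e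
  where
  lem : ∀ c a e → c + (a + e) * 0 ≡ c + a * 0 + e * 0
  lem = solve-∀
eval-quotientBy (c ∷ d ∷ ds) a e = begin-equality
  c + (a + e) * eval f (a + e)
    ≡⟨ cong (λ z → c + z) (*-distribʳ-+ (eval f (a + e)) a e) ⟩
  c + (a * eval f (a + e) + e * eval f (a + e))
    ≡⟨ cong (λ z → c + (a * z + e * z)) (eval-quotientBy f a e) ⟩
  c + (a * (eval f a + e * q) + e * (eval f a + e * q))
    ≡⟨ lem c a e (eval f a) q ⟩
  c + a * eval f a + e * (eval f a + (a + e) * q) ∎
  where
  open ≤-Reasoning
  f = d ∷ ds
  q = eval (quotientBy a f) (a + e)
  lem : ∀ c a e f q → c + (a * (f + e * q) + e * (f + e * q)) ≡ c + a * f + e * (f + (a + e) * q)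
  lem = solve-∀

-- Lagrange's bound on the number of roots, for n coefficients and n consecutive arguments from a
-- on. The quotient by X - a vanishes at the other arguments, because their distances j from a
-- satisfy 0 < j < p and cannot absorb the factor p.
manyRoots⇒vanishing : ∀ {p} → Prime p → ∀ n (f : Vec ℕ n) a → n ≤ p →
  (∀ i → i < n → p ∣ eval f (a + i)) → ∀ i → p ∣ eval f (a + i)
manyRoots⇒vanishing pr zero [] a _ _ i = _ ∣0
manyRoots⇒vanishing {p} pr (suc n) f a n<p root zero = root 0 z<s
manyRoots⇒vanishing {p} pr (suc n) f a n<p root (suc i) =
  subst (p ∣_) (sym (eval-quotientBy f a (suc i)))
    (∣m∣n⇒∣m+n p∣fa (∣n⇒∣m*n (suc i)
      (subst (λ z → p ∣ eval (quotientBy a f) z) (sym (+-suc a i))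
        (manyRoots⇒vanishing pr n (quotientBy a f) (suc a) (<⇒≤ n<p) rootQ i))))
  where
  p∣fa : p ∣ eval f a
  p∣fa = subst (λ z → p ∣ eval f z) (+-identityʳ a) (root 0 z<s)
  rootQ : ∀ j → j < n → p ∣ eval (quotientBy a f) (suc a + j)
  rootQ j j<n = subst (λ z → p ∣ eval (quotientBy a f) z) (+-suc a j)
    ([ (λ d → contradiction d (>⇒∤ (<-≤-trans (s<s j<n) n<p))) , id ]′
      (euclidsLemma (suc j) _ pr
        (∣m+n∣m⇒∣n (subst (p ∣_) (eval-quotientBy f a (suc j)) (root (suc j) (s<s j<n))) p∣fa)))

monomial : ∀ n → Vec ℕ (suc n)
monomial zero    = 1 ∷ []
monomial (suc n) = 0 ∷ monomial n

eval-monomial : ∀ n x → eval (monomial n) x ≡ x ^ n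
eval-monomial zero    x = cong suc (*-zeroʳ x)
eval-monomial (suc n) x = cong (x *_) (eval-monomial n x)

-- Congruences and orders modulo a prime

module Congruence (m : ℕ) {{_ : NonZero m}} where

  infix 4 _≈_
  _≈_ : ℕ → ℕ → Set
  a ≈ b = a % m ≡ b % m

  ≈-+ : ∀ {a b c d} → a ≈ b → c ≈ d → a + c ≈ b + d
  ≈-+ {a} {b} {c} {d} p q = trans (%-distribˡ-+ a c m)
    (trans (cong₂ (λ x y → (x + y) % m) p q) (sym (%-distribˡ-+ b d m)))

  ≈-* : ∀ {a b c d} → a ≈ b → c ≈ d → a * c ≈ b * d
  ≈-* {a} {b} {c} {d} p q = trans (%-distribˡ-* a c m)
    (trans (cong₂ (λ x y → (x * y) % m) p q) (sym (%-distribˡ-* b d m)))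

  ≈-^ : ∀ {a b} k → a ≈ b → a ^ k ≈ b ^ k
  ≈-^ zero    p = refl
  ≈-^ (suc k) p = ≈-* p (≈-^ k p)

  ≈1-^ : ∀ {a} k → a ≈ 1 → a ^ k ≈ 1
  ≈1-^ k p = trans (≈-^ k p) (cong (_% m) (^-zeroˡ k))

  ≈1-* : ∀ {a b} → a ≈ 1 → a * b ≈ b
  ≈1-* {a} {b} p = trans (≈-* {a} {1} {b} {b} p refl) (cong (_% m) (*-identityˡ b))

  ∣⇒≈0 : ∀ {a} → m ∣ a → a ≈ 0
  ∣⇒≈0 d = trans (n∣m⇒m%n≡0 _ m d) (sym (m*n%n≡0 0 m))

  ≈0⇒∣ : ∀ {a} → a ≈ 0 → m ∣ a
  ≈0⇒∣ p = m%n≡0⇒n∣m _ m (trans p (m*n%n≡0 0 m))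

  -- Adding a (m - 1) replaces the subtraction of a, since a + a (m - 1) is a multiple of m.
  ≈-cancelˡ : ∀ a {e} → a + e ≈ a → m ∣ e
  ≈-cancelˡ a {e} p = ≈0⇒∣ (begin
    e % m                    ≡⟨ [m+kn]%n≡m%n e a m ⟨
    (e + a * m) % m          ≡⟨ cong (λ z → (e + z) % m) multiple ⟨
    (e + (a + a * pred m)) % m ≡⟨ cong (_% m) (lem e a (a * pred m)) ⟩
    (a + e + a * pred m) % m ≡⟨ ≈-+ {a + e} {a} {a * pred m} p refl ⟩
    (a + a * pred m) % m     ≡⟨ cong (_% m) multiple ⟩
    (a * m) % m              ≡⟨ ∣⇒≈0 (divides a refl) ⟩
    0 % m                    ∎)
    where
    open ≡-Reasoning
    multiple : a + a * pred m ≡ a * m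
    multiple = trans (sym (*-suc a (pred m))) (cong (a *_) (suc-pred m))
    lem : ∀ e a b → e + (a + b) ≡ a + e + b
    lem = solve-∀

module PrimeModulus {p : ℕ} (pr : Prime p) where

  instance
    p≢0 : NonZero p
    p≢0 = prime⇒nonZero pr

  open Congruence p public

  0<p-1 : 0 < pred p
  0<p-1 = pred-mono-≤ (prime>1 pr)

  ∤-^ : ∀ {x} k → p ∤ x → p ∤ x ^ k
  ∤-^ zero    _   d = contradiction (∣1⇒≡1 d) (≢-sym (<⇒≢ (prime>1 pr)))
  ∤-^ (suc k) p∤x d = [ p∤x , ∤-^ k p∤x ]′ (euclidsLemma _ _ pr d)

  ≈-cancel-* : ∀ {x} y → p ∤ x → x * y ≈ x → y ≈ 1
  ≈-cancel-* {x} zero    p∤x eq = contradiction (≈0⇒∣ (trans (sym eq) (cong (_% p) (*-zeroʳ x)))) p∤x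
  ≈-cancel-* {x} (suc y) p∤x eq =
    [ (λ p∣x → contradiction p∣x p∤x) , (λ p∣y → %-remove-+ʳ 1 p∣y) ]′
      (euclidsLemma x y pr (≈-cancelˡ x (trans (cong (_% p) (sym (*-suc x y))) eq)))

  ≈-cancel-^ : ∀ {x} i e → p ∤ x → x ^ (i + e) ≈ x ^ i → x ^ e ≈ 1
  ≈-cancel-^ {x} i e p∤x eq =
    ≈-cancel-* (x ^ e) (∤-^ i p∤x) (trans (cong (_% p) (sym (^-distribˡ-+-* x i e))) eq)

  freshman : ∀ x → (1 + x) ^ p ≈ 1 + x ^ p
  freshman x = begin
    (1 + x) ^ p % p                          ≡⟨ cong (_% p) (binomialTheorem x p) ⟨
    (binomialSum x p p + (p C p) * x ^ p) % p ≡⟨ cong (λ z → (binomialSum x p p + z * x ^ p) % p) (nCn≡1 p) ⟩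
    (binomialSum x p p + 1 * x ^ p) % p      ≡⟨ ≈-+ {binomialSum x p p} {1} {1 * x ^ p} {x ^ p}
                                                  (lowerTerms p (<-trans z<s (prime>1 pr)) ≤-refl) (cong (_% p) (*-identityˡ (x ^ p))) ⟩
    (1 + x ^ p) % p                          ∎
    where
    open ≡-Reasoning
    lowerTerms : ∀ k → 0 < k → k ≤ p → binomialSum x p k ≈ 1
    lowerTerms (suc zero)    _ _   = cong (λ z → z * 1 % p) (nC0≡1 p)
    lowerTerms (suc (suc k)) _ k<p = trans
      (%-remove-+ʳ _ (∣m⇒∣m*n (x ^ suc k) (prime∣pCk pr z<s k<p))) (lowerTerms (suc k) z<s (<⇒≤ k<p))

  x^p≈x : ∀ x → x ^ p ≈ x
  x^p≈x zero    = ∣⇒≈0 (subst (λ n → p ∣ 0 ^ n) (suc-pred p) (_ ∣0))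
  x^p≈x (suc x) = trans (freshman x) (≈-+ {1} {1} {x ^ p} {x} refl (x^p≈x x))

  fermat : ∀ {x} → p ∤ x → x ^ pred p ≈ 1
  fermat {x} p∤x = ≈-cancel-* _ p∤x (trans (cong (λ n → x ^ n % p) (suc-pred p)) (x^p≈x x))

  -- Otherwise X^t + (p - 1), which has t + 1 coefficients, vanishes modulo p at 1, ..., t + 1 and
  -- so at every positive integer. Its value at p is congruent to p - 1, a contradiction.
  ∃x^t≉1 : ∀ t → 0 < t → t < pred p → ∃ λ x → p ∤ x × ¬ (x ^ t ≈ 1)
  ∃x^t≉1 (suc t) _ t<p-1 with anyUpTo? (λ i → ¬? (suc i ^ suc t % p ≟ 1 % p)) (suc (suc t))
  ... | yes (i , i<t , ≉1) = suc i , >⇒∤ (≤-<-trans i<t (subst (suc (suc t) <_) (suc-pred p) (s<s t<p-1))) , ≉1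
  ... | no  ∄ = contradiction p∣p-1 (>⇒∤ {{>-nonZero (<-trans z<s t<p-1)}} (subst (pred p <_) (suc-pred p) ≤-refl))
    where
    f : Vec ℕ (suc (suc t))
    f = pred p ∷ monomial t

    root : ∀ i → i < suc (suc t) → p ∣ eval f (1 + i)
    root i i<t = ≈0⇒∣ (begin
      (pred p + suc i * eval (monomial t) (suc i)) % p ≡⟨ cong (λ z → (pred p + suc i * z) % p) (eval-monomial t (suc i)) ⟩
      (pred p + suc i ^ suc t) % p ≡⟨ ≈-+ {pred p} {pred p} {suc i ^ suc t} {1} refl
                                       (decidable-stable (_ ≟ _) λ ≉1 → ∄ (i , i<t , ≉1)) ⟩
      (pred p + 1) % p             ≡⟨ cong (_% p) (trans (+-comm (pred p) 1) (suc-pred p)) ⟩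
      p % p                        ≡⟨ ∣⇒≈0 ∣-refl ⟩
      0 % p                        ∎)
      where open ≡-Reasoning

    p∣fp : p ∣ eval f p
    p∣fp = subst (λ z → p ∣ eval f z) (suc-pred p)
      (manyRoots⇒vanishing pr (suc (suc t)) f 1 (≤-trans t<p-1 (pred[n]≤n {p})) root (pred p))

    p∣p-1 : p ∣ pred p
    p∣p-1 = ∣m+n∣m⇒∣n (subst (p ∣_) (+-comm (pred p) _) p∣fp) (m∣m*n _)

  HasOrder : ℕ → ℕ → Set
  HasOrder x d = x ^ d ≈ 1 × (∀ i → x ^ i ≈ 1 → d ∣ i)

  ^-gcd : ∀ {x} a b → x ^ a ≈ 1 → x ^ b ≈ 1 → x ^ gcd a b ≈ 1
  ^-gcd {x} a b xa xb = helper (Bézout.identity (gcd-GCD a b))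
    where
    multiple : ∀ {a} u → x ^ a ≈ 1 → x ^ (u * a) ≈ 1
    multiple {a} u xa = trans (cong (_% p) (trans (cong (x ^_) (*-comm u a)) (sym (^-*-assoc x a u)))) (≈1-^ u xa)

    -- Bézout's identity in ℕ reads d + k = l with x^k ≡ x^l ≡ 1; multiplying by x^k avoids
    -- inverses.
    cancel : ∀ {d} k l → x ^ k ≈ 1 → x ^ l ≈ 1 → d + k ≡ l → x ^ d ≈ 1
    cancel {d} k l xk xl eq = begin
      x ^ d % p           ≡⟨ ≈1-* {x ^ k} {x ^ d} xk ⟨
      (x ^ k * x ^ d) % p ≡⟨ cong (_% p) (^-distribˡ-+-* x k d) ⟨
      x ^ (k + d) % p     ≡⟨ cong (λ n → x ^ n % p) (trans (+-comm k d) eq) ⟩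
      x ^ l % p           ≡⟨ xl ⟩
      1 % p               ∎
      where open ≡-Reasoning

    helper : Bézout.Identity (gcd a b) a b → x ^ gcd a b ≈ 1
    helper (Bézout.+- u v eq) = cancel (v * b) (u * a) (multiple v xb) (multiple u xa) eq
    helper (Bézout.-+ u v eq) = cancel (u * a) (v * b) (multiple u xa) (multiple v xb) eq

  -- Raising (x y)^i ≡ 1 to the power a removes x and leaves y^(a i) ≡ 1, so b divides a i and, by
  -- coprimality, i; symmetrically for a.
  order-* : ∀ {x y a b} → Coprime a b → HasOrder x a → HasOrder y b → HasOrder (x * y) (a * b)
  order-* {x} {y} {a} {b} cop (xa , ordx) (yb , ordy) = xyab , λ i xyi →
    coprime-*-∣ cop
      (Coprime.coprime-divisor cop (ordx (b * i) (raise y b i yb (trans (cong (λ z → z ^ i % p) (*-comm y x)) xyi))))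
      (Coprime.coprime-divisor (Coprime.sym cop) (ordy (a * i) (raise x a i xa xyi)))
    where
    open ≡-Reasoning

    raise : ∀ x {y} a i → x ^ a ≈ 1 → (x * y) ^ i ≈ 1 → y ^ (a * i) ≈ 1
    raise x {y} a i xa xyi = begin
      y ^ (a * i) % p                 ≡⟨ ≈1-* {x ^ (a * i)} {y ^ (a * i)} (trans (cong (_% p) (sym (^-*-assoc x a i))) (≈1-^ i xa)) ⟨
      (x ^ (a * i) * y ^ (a * i)) % p ≡⟨ cong (_% p) (^-distribʳ-* (a * i) x y) ⟨
      (x * y) ^ (a * i) % p           ≡⟨ cong (λ n → (x * y) ^ n % p) (*-comm a i) ⟩
      (x * y) ^ (i * a) % p           ≡⟨ cong (_% p) (^-*-assoc (x * y) i a) ⟨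
      ((x * y) ^ i) ^ a % p           ≡⟨ ≈1-^ a xyi ⟩
      1 % p                           ∎

    xyab : (x * y) ^ (a * b) ≈ 1
    xyab = begin
      (x * y) ^ (a * b) % p           ≡⟨ cong (_% p) (^-distribʳ-* (a * b) x y) ⟩
      (x ^ (a * b) * y ^ (a * b)) % p ≡⟨ ≈1-* {x ^ (a * b)} (trans (cong (_% p) (sym (^-*-assoc x a b))) (≈1-^ b xa)) ⟩
      y ^ (a * b) % p                 ≡⟨ cong (λ n → y ^ n % p) (*-comm a b) ⟩
      y ^ (b * a) % p                 ≡⟨ cong (_% p) (^-*-assoc y b a) ⟨
      (y ^ b) ^ a % p                 ≡⟨ ≈1-^ a yb ⟩
      1 % p                           ∎

  -- With p - 1 = c q^(e+1), choose x with x^((p-1)/q) ≢ 1. Then x^c has order q^(e+1): Fermat gives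
  -- the exponent, and an order dividing q^e would make x^((p-1)/q) trivial.
  order-primePower : ∀ {q} → Prime q → ∀ e → q ^ e ∣ pred p → ∃ λ x → HasOrder x (q ^ e)
  order-primePower prq zero _ = 1 , refl , λ i _ → 1∣ i
  order-primePower {q} prq (suc e) (divides c eq) =
    let x , p∤x , x^t≉1 = ∃x^t≉1 (q ^ e * c) 0<t t<p-1 in x ^ c , y^qᵉ⁺¹≈1 p∤x , minimal p∤x x^t≉1
    where
    lem : ∀ a b c → a * (b * c) ≡ c * a * b
    lem = solve-∀
    p-1≡tq : pred p ≡ q ^ e * c * q
    p-1≡tq = trans eq (lem c q (q ^ e))
    0<t : 0 < q ^ e * c
    0<t = n≢0⇒n>0 λ t≡0 → n>0⇒n≢0 0<p-1 (trans p-1≡tq (cong (_* q) t≡0))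
    t<p-1 : q ^ e * c < pred p
    t<p-1 = subst (q ^ e * c <_) (sym p-1≡tq) (m<m*n (q ^ e * c) q {{>-nonZero 0<t}} (prime>1 prq))

    module _ {x} (p∤x : p ∤ x) where
      y^qᵉ⁺¹≈1 : (x ^ c) ^ (q ^ suc e) ≈ 1
      y^qᵉ⁺¹≈1 = trans (cong (_% p) (trans (^-*-assoc x c (q ^ suc e)) (cong (x ^_) (sym eq)))) (fermat p∤x)

      minimal : ¬ (x ^ (q ^ e * c) ≈ 1) → ∀ i → (x ^ c) ^ i ≈ 1 → q ^ suc e ∣ i
      minimal x^t≉1 i ≈1 with ∣primePower prq e (gcd[m,n]∣n i (q ^ suc e))
      ... | inj₁ gcd≡ = subst (_∣ i) gcd≡ (gcd[m,n]∣m i (q ^ suc e))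
      ... | inj₂ (divides k qᵉ≡) = contradiction
        (begin
          x ^ (q ^ e * c) % p    ≡⟨ cong (λ n → x ^ n % p) (*-comm (q ^ e) c) ⟩
          x ^ (c * q ^ e) % p    ≡⟨ cong (_% p) (^-*-assoc x c (q ^ e)) ⟨
          (x ^ c) ^ (q ^ e) % p  ≡⟨ cong (λ n → (x ^ c) ^ n % p) (trans qᵉ≡ (*-comm k _)) ⟩
          (x ^ c) ^ (gcd i (q ^ suc e) * k) % p ≡⟨ cong (_% p) (^-*-assoc (x ^ c) (gcd i (q ^ suc e)) k) ⟨
          ((x ^ c) ^ gcd i (q ^ suc e)) ^ k % p ≡⟨ ≈1-^ k (^-gcd i (q ^ suc e) ≈1 y^qᵉ⁺¹≈1) ⟩
          1 % p                  ∎)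
        x^t≉1
        where open ≡-Reasoning

  -- Induction on d: the full power of a prime is split off, so the remaining factor is coprime to
  -- it and `order-*` multiplies the two elements.
  order-divisor : ∀ d → 0 < d → d ∣ pred p → ∃ λ x → HasOrder x d
  order-divisor = <-rec _ go
    where
    go : ∀ d → (∀ {m} → m < d → 0 < m → m ∣ pred p → ∃ λ x → HasOrder x m) →
         0 < d → d ∣ pred p → ∃ λ x → HasOrder x d
    go (suc zero)        _   _   _ = 1 , refl , λ i _ → 1∣ i
    go d@(suc (suc d-2)) rec 0<d d∣p-1 with primeDivisor d (s<s z<s)
    ... | q , prq , q∣d with factorOut q (prime>1 prq) d 0<d
    ...   | zero  , m , eq , q∤m = contradiction (subst (q ∣_) (trans eq (*-identityˡ m)) q∣d) q∤m
    ...   | suc k , m , eq , q∤m =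
      let x , ordx = order-primePower prq (suc k) (∣-trans (subst (q ^ suc k ∣_) (sym eq) (m∣m*n m)) d∣p-1)
          y , ordy = rec m<d 0<m (∣-trans (subst (m ∣_) (sym eq) (n∣m*n (q ^ suc k))) d∣p-1)
      in x * y , subst (HasOrder (x * y)) (sym eq)
                   (order-* (coprime-^ (suc k) (prime∤⇒coprime prq q∤m)) ordx ordy)
      where
      0<m : 0 < m
      0<m = n≢0⇒n>0 λ m≡0 → q∤m (subst (q ∣_) (sym m≡0) (_ ∣0))
      1<qᵏ : 1 < q ^ suc k
      1<qᵏ = <-≤-trans (prime>1 prq) (m≤m*n q (q ^ k) {{m^n≢0 q k {{prime⇒nonZero prq}}}})
      m<d : m < d
      m<d = subst (m <_) (trans (*-comm m _) (sym eq)) (m<m*n m (q ^ suc k) {{>-nonZero 0<m}} 1<qᵏ)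

  primitiveRoot : ∃ λ g → HasOrder g (pred p)
  primitiveRoot = order-divisor (pred p) 0<p-1 ∣-refl

-- Ruzsa's Sidon set

module Ruzsa {p : ℕ} (pr : Prime p) where

  open PrimeModulus pr

  k : ℕ
  k = pred p

  instance
    k≢0 : NonZero k
    k≢0 = >-nonZero 0<p-1

    pk≢0 : NonZero (p * k)
    pk≢0 = m*n≢0 p k

  1+k≡p : suc k ≡ p
  1+k≡p = suc-pred p

  module ModPred = Congruence k

  -- k ≡ -1 modulo p, so p ∣ (u + k w) (u + k z) says that (u - w) (u - z) vanishes modulo p.
  sumProduct⇒≈ : ∀ {u v w z} → u + v ≈ w + z → u * v ≈ w * z → u ≈ w ⊎ u ≈ z
  sumProduct⇒≈ {u} {v} {w} {z} sum prod =
    [ inj₁ ∘ negate w , inj₂ ∘ negate z ]′ (euclidsLemma (u + k * w) (u + k * z) pr (≈0⇒∣ (begin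
      (u + k * w) * (u + k * z) % p
        ≡⟨ cong (_% p) (lem₁ k u w z) ⟩
      (u * u + (k * u) * (w + z) + (k * k) * (w * z)) % p
        ≡⟨ ≈-+ (≈-+ {u * u} refl (≈-* {k * u} refl sum)) (≈-* {k * k} refl prod) ⟨
      (u * u + (k * u) * (u + v) + (k * k) * (u * v)) % p
        ≡⟨ cong (_% p) (lem₂ k u v) ⟩
      suc k * (u * u + k * (u * v)) % p
        ≡⟨ cong (λ m → m * (u * u + k * (u * v)) % p) 1+k≡p ⟩
      p * (u * u + k * (u * v)) % p
        ≡⟨ ∣⇒≈0 (m∣m*n _) ⟩
      0 % p ∎)))
    where
    open ≡-Reasoning
    lem₁ : ∀ k u w z → (u + k * w) * (u + k * z) ≡ u * u + (k * u) * (w + z) + (k * k) * (w * z)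
    lem₁ = solve-∀
    lem₂ : ∀ k u v → u * u + (k * u) * (u + v) + (k * k) * (u * v) ≡ suc k * (u * u + k * (u * v))
    lem₂ = solve-∀
    lem₃ : ∀ k u w → u + suc k * w ≡ u + k * w + w
    lem₃ = solve-∀

    negate : ∀ w → p ∣ u + k * w → u ≈ w
    negate w d = begin
      u % p                 ≡⟨ %-remove-+ʳ u (m∣m*n {p} w) ⟨
      (u + p * w) % p       ≡⟨ cong (λ m → (u + m * w) % p) 1+k≡p ⟨
      (u + suc k * w) % p   ≡⟨ cong (_% p) (lem₃ k u w) ⟩
      (u + k * w + w) % p   ≡⟨ %-remove-+ˡ w d ⟩
      w % p                 ∎

  module _ (g : ℕ) (ord : HasOrder g k) where

    g∤ : p ∤ g
    g∤ p∣g = contradiction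
      (∣1⇒≡1 (≈0⇒∣ (trans (sym (proj₁ ord)) (∣⇒≈0 (subst (λ n → p ∣ g ^ n) (suc-pred k) (∣m⇒∣m*n _ p∣g))))))
      (≢-sym (<⇒≢ (prime>1 pr)))

    ^-reduce : ∀ a → g ^ a ≈ g ^ (a % k)
    ^-reduce a = begin
      g ^ a % p                             ≡⟨ cong (λ n → g ^ n % p) (trans (m≡m%n+[m/n]*n a k) (trans (+-comm (a % k) _) (cong (_+ a % k) (*-comm (a / k) k)))) ⟩
      g ^ (k * (a / k) + a % k) % p         ≡⟨ cong (_% p) (^-distribˡ-+-* g (k * (a / k)) (a % k)) ⟩
      g ^ (k * (a / k)) * g ^ (a % k) % p   ≡⟨ ≈1-* {g ^ (k * (a / k))} {g ^ (a % k)} (trans (cong (_% p) (sym (^-*-assoc g k (a / k)))) (≈1-^ (a / k) (proj₁ ord))) ⟩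
      g ^ (a % k) % p                       ∎
      where open ≡-Reasoning

    ^-cong : ∀ a b → a ModPred.≈ b → g ^ a ≈ g ^ b
    ^-cong a b eq = trans (^-reduce a) (trans (cong (λ n → g ^ n % p) eq) (sym (^-reduce b)))

    ^-injective-≤ : ∀ {i j} → i ≤ j → j < k → g ^ i ≈ g ^ j → i ≡ j
    ^-injective-≤ {i} i≤j j<k eq with m≤n⇒∃[o]m+o≡n i≤j
    ... | zero  , refl = sym (+-identityʳ i)
    ... | suc e , refl = contradiction (proj₂ ord (suc e) (≈-cancel-^ i (suc e) g∤ (sym eq)))
                                       (>⇒∤ (≤-<-trans (m≤n+m (suc e) i) j<k))

    ^-injective : ∀ {i j} → i < k → j < k → g ^ i ≈ g ^ j → i ≡ j
    ^-injective {i} {j} i<k j<k eq with ≤-total i j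
    ... | inj₁ i≤j = ^-injective-≤ i≤j j<k eq
    ... | inj₂ j≤i = sym (^-injective-≤ j≤i i<k (sym eq))

    -- The solution of x ≡ i (mod p - 1), x ≡ gⁱ (mod p) given by the Chinese remainder theorem.
    crt : ℕ → ℕ
    crt i = p * i + k * k * g ^ i

    b : ℕ → ℕ
    b i = crt i % (p * k)

    b≈gⁱ : ∀ i → b i ≈ g ^ i
    b≈gⁱ i = begin
      b i % p                     ≡⟨ m∣n⇒o%n%m≡o%m p (p * k) (crt i) (m∣m*n k) ⟩
      crt i % p                   ≡⟨ %-remove-+ˡ (k * k * g ^ i) (m∣m*n {p} i) ⟩
      k * k * g ^ i % p           ≡⟨ ≈1-* {k * k} {g ^ i} k²≈1 ⟩
      g ^ i % p                   ∎
      where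
      open ≡-Reasoning
      lem : ∀ a → suc a * suc a ≡ 1 + a * suc (suc a)
      lem = solve-∀
      -- Since k² = 1 + (k - 1)(k + 1) and k + 1 = p, the coefficient k² in `crt` is 1 modulo p,
      -- while it is 0 modulo k.
      k²≈1 : k * k ≈ 1
      k²≈1 = begin
        k * k % p                            ≡⟨ cong (λ n → n * n % p) (suc-pred k) ⟨
        suc (pred k) * suc (pred k) % p      ≡⟨ cong (_% p) (lem (pred k)) ⟩
        (1 + pred k * suc (suc (pred k))) % p ≡⟨ cong (λ n → (1 + pred k * n) % p) (trans (cong suc (suc-pred k)) 1+k≡p) ⟩
        (1 + pred k * p) % p                 ≡⟨ [m+kn]%n≡m%n 1 (pred k) p ⟩
        1 % p                                ∎

    b≈i : ∀ i → b i ModPred.≈ i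
    b≈i i = begin
      b i % k                              ≡⟨ m∣n⇒o%n%m≡o%m k (p * k) (crt i) (n∣m*n p) ⟩
      crt i % k                            ≡⟨ cong (λ m → (m * i + k * k * g ^ i) % k) 1+k≡p ⟨
      (suc k * i + k * k * g ^ i) % k      ≡⟨ cong (_% k) (lem k i (g ^ i)) ⟩
      (i + (i + k * g ^ i) * k) % k        ≡⟨ [m+kn]%n≡m%n i (i + k * g ^ i) k ⟩
      i % k                                ∎
      where
      open ≡-Reasoning
      lem : ∀ k i x → suc k * i + k * k * x ≡ i + (i + k * x) * k
      lem = solve-∀

    b-injective : ∀ {i j} → i < k → j < k → b i ≡ b j → i ≡ j
    b-injective {i} {j} i<k j<k eq = begin
      i        ≡⟨ m<n⇒m%n≡m i<k ⟨
      i % k    ≡⟨ b≈i i ⟨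
      b i % k  ≡⟨ cong (_% k) eq ⟩
      b j % k  ≡⟨ b≈i j ⟩
      j % k    ≡⟨ m<n⇒m%n≡m j<k ⟩
      j        ∎
      where open ≡-Reasoning

    -- Matching one summand is enough: the other one follows by cancellation in ℤ.
    b-sidon : ∀ {i j i′ j′} → i < k → i′ < k → j′ < k → b i + b j ≡ b i′ + b j′ → i ≡ i′ ⊎ i ≡ j′
    b-sidon {i} {j} {i′} {j′} i<k i′<k j′<k eq =
      [ inj₁ ∘ ^-injective i<k i′<k , inj₂ ∘ ^-injective i<k j′<k ]′ (sumProduct⇒≈ {g ^ i} {g ^ j} sum prod)
      where
      open ≡-Reasoning
      sum : g ^ i + g ^ j ≈ g ^ i′ + g ^ j′
      sum = begin
        (g ^ i + g ^ j) % p    ≡⟨ ≈-+ {b i} {g ^ i} {b j} {g ^ j} (b≈gⁱ i) (b≈gⁱ j) ⟨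
        (b i + b j) % p        ≡⟨ cong (_% p) eq ⟩
        (b i′ + b j′) % p      ≡⟨ ≈-+ {b i′} {g ^ i′} {b j′} {g ^ j′} (b≈gⁱ i′) (b≈gⁱ j′) ⟩
        (g ^ i′ + g ^ j′) % p  ∎
      exponents : i + j ModPred.≈ i′ + j′
      exponents = begin
        (i + j) % k            ≡⟨ ModPred.≈-+ {b i} {i} {b j} {j} (b≈i i) (b≈i j) ⟨
        (b i + b j) % k        ≡⟨ cong (_% k) eq ⟩
        (b i′ + b j′) % k      ≡⟨ ModPred.≈-+ {b i′} {i′} {b j′} {j′} (b≈i i′) (b≈i j′) ⟩
        (i′ + j′) % k          ∎
      prod : g ^ i * g ^ j ≈ g ^ i′ * g ^ j′
      prod = begin
        g ^ i * g ^ j % p      ≡⟨ cong (_% p) (^-distribˡ-+-* g i j) ⟨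
        g ^ (i + j) % p        ≡⟨ ^-cong (i + j) (i′ + j′) exponents ⟩
        g ^ (i′ + j′) % p      ≡⟨ cong (_% p) (^-distribˡ-+-* g i′ j′) ⟩
        g ^ i′ * g ^ j′ % p    ∎

    -- The shift by one moves the residues 0, ..., p (p - 1) - 1 into {1, ..., p (p - 1)}; a
    -- translate of a Sidon set is Sidon.
    element : ℕ → ℤ
    element i = ℤ.+ suc (b i)

    ruzsaSet : List ℤ
    ruzsaSet = applyUpTo element k

    ruzsaSet-sidon : Sidon ruzsaSet
    ruzsaSet-sidon a∈ b∈ c∈ d∈ eq
      with ∈-applyUpTo⁻ element a∈ | ∈-applyUpTo⁻ element b∈ | ∈-applyUpTo⁻ element c∈ | ∈-applyUpTo⁻ element d∈
    ... | i , i<k , refl | j , j<k , refl | i′ , i′<k , refl | j′ , j′<k , refl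
      with b-sidon {i} {j} {i′} {j′} i<k i′<k j′<k (suc-injective (suc-injective
             (trans (sym (cong suc (+-suc (b i) (b j)))) (trans (ℤ.+-injective eq) (cong suc (+-suc (b i′) (b j′)))))))
    ... | inj₁ refl = inj₁ (refl , ∙-cancelˡ ℤ.+-0-abelianGroup (element i) _ _ eq)
    ... | inj₂ refl = inj₂ (refl , ∙-cancelˡ ℤ.+-0-abelianGroup (element i) _ _ (trans eq (ℤ.+-comm (element i′) (element i))))

    ruzsaSet-in : ∀ {N} → p * k ≤ N → SidonIn N ruzsaSet
    ruzsaSet-in {N} pk≤N =
      UniqueP.applyUpTo⁺₁ element k (λ i<j j<k eq →
        <⇒≢ i<j (b-injective (<-trans i<j j<k) j<k (suc-injective (ℤ.+-injective eq)))) ,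
      AllP.applyUpTo⁺₁ element k (λ {i} _ → ℤ.+≤+ (s≤s z≤n) , ℤ.+≤+ (≤-trans (m%n<n (crt i) (p * k)) pk≤N)) ,
      ruzsaSet-sidon

  ruzsa : ∀ {N} → p * k ≤ N → k ≤ h N
  ruzsa {N} pk≤N = let g , ord = primitiveRoot in
    subst (_≤ h N) (length-applyUpTo (element g ord) k) (h-upper N (ruzsaSet g ord) (ruzsaSet-in g ord pk≤N))

nCk>0 : ∀ {n k} → k ≤ n → 0 < n C k
nCk>0 {n} {zero}  _ = subst (0 <_) (sym (nC0≡1 n)) z<s
nCk>0 {suc n} {suc k} (s≤s k≤n) =
  subst (0 <_) (nCk+nC[k+1]≡[n+1]C[k+1] n k) (<-≤-trans (nCk>0 k≤n) (m≤m+n _ _))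

-- Leibniz's harmonic triangle

-- Since 1/c = 1/a - 1/b, the number c divides every common multiple of a and b.
harmonic-∣ : ∀ {a b c m} → 0 < a → 0 < b → b * c ≡ a * (b + c) → a ∣ m → b ∣ m → c ∣ m
harmonic-∣ {a} {b} {c} {m} 0<a 0<b eq (divides x m≡xa) (divides y m≡yb) =
  ∣m+n∣m⇒∣n (divides x (*-cancelˡ-≡ _ _ (a * b) {{>-nonZero (*-mono-< 0<a 0<b)}} (begin
    a * b * (y * c + m)             ≡⟨ lem₁ a b y c m ⟩
    a * (b * m + c * (y * b))       ≡⟨ cong (λ z → a * (b * m + c * z)) m≡yb ⟨
    a * (b * m + c * m)             ≡⟨ lem₂ a b c m ⟩
    a * (b + c) * m                 ≡⟨ cong₂ _*_ (sym eq) m≡xa ⟩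
    b * c * (x * a)                 ≡⟨ lem₃ a b c x ⟩
    a * b * (x * c)                 ∎))) (n∣m*n y)
  where
  open ≡-Reasoning
  lem₁ : ∀ a b y c m → a * b * (y * c + m) ≡ a * (b * m + c * (y * b))
  lem₁ = solve-∀
  lem₂ : ∀ a b c m → a * (b * m + c * m) ≡ a * (b + c) * m
  lem₂ = solve-∀
  lem₃ : ∀ a b c x → b * c * (x * a) ≡ a * b * (x * c)
  lem₃ = solve-∀

-- The numbers (n + 1) C(n, k) are the reciprocals of the entries of Leibniz's triangle. In column 0
-- they are the integers n + 1 themselves; every other one is reached by `harmonic-∣` from two
-- entries of the column to its left.
[n+1]nCk∣commonMultiple : ∀ {m} n k → k ≤ n → (∀ i → 0 < i → i ≤ suc n → i ∣ m) → suc n * (n C k) ∣ m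
[n+1]nCk∣commonMultiple {m} n zero _ mult =
  subst (_∣ m) (sym (trans (cong (suc n *_) (nC0≡1 n)) (*-identityʳ (suc n)))) (mult (suc n) z<s ≤-refl)
[n+1]nCk∣commonMultiple {m} (suc n) (suc k) (s≤s k≤n) mult =
  harmonic-∣ {suc n * (n C k)} {suc (suc n) * (suc n C k)}
    (*-mono-< {0} {suc n} z<s (nCk>0 k≤n)) (*-mono-< {0} {suc (suc n)} z<s (nCk>0 (m≤n⇒m≤1+n k≤n)))
    (begin
      N * x * (N * y)                     ≡⟨ lem₁ N x y ⟩
      N * y * (N * x)                     ≡⟨ cong (N * y *_) (absorption (suc n) k) ⟨
      N * y * (suc k * z)                 ≡⟨ lem₂ N y (suc k) z ⟩
      suc k * y * (N * z)                 ≡⟨ cong₂ (λ u v → u * (N * v)) (absorption n k) (sym (nCk+nC[k+1]≡[n+1]C[k+1] (suc n) k)) ⟩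
      suc n * (n C k) * (N * (x + y))     ≡⟨ cong (suc n * (n C k) *_) (*-distribˡ-+ N x y) ⟩
      suc n * (n C k) * (N * x + N * y)   ∎)
    ([n+1]nCk∣commonMultiple n k k≤n (λ i 0<i i≤n → mult i 0<i (m≤n⇒m≤1+n i≤n)))
    ([n+1]nCk∣commonMultiple (suc n) k (m≤n⇒m≤1+n k≤n) mult)
  where
  open ≡-Reasoning
  N = suc (suc n)
  x = suc n C k
  y = suc n C suc k
  z = suc (suc n) C suc k
  lem₁ : ∀ N x y → N * x * (N * y) ≡ N * y * (N * x)
  lem₁ = solve-∀
  lem₂ : ∀ N y k z → N * y * (k * z) ≡ k * y * (N * z)
  lem₂ = solve-∀

-- Prime powers dividing binomial coefficients

lcmUpTo : ℕ → ℕ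
lcmUpTo zero    = 1
lcmUpTo (suc n) = lcm (lcmUpTo n) (suc n)

∣lcmUpTo : ∀ n i → 0 < i → i ≤ n → i ∣ lcmUpTo n
∣lcmUpTo zero    i 0<i i≤0 = contradiction (<-≤-trans 0<i i≤0) λ ()
∣lcmUpTo (suc n) i 0<i i≤n with m≤n⇒m<n∨m≡n i≤n
... | inj₁ i<n  = ∣-trans (∣lcmUpTo n i 0<i (≤-pred i<n)) (m∣lcm[m,n] (lcmUpTo n) (suc n))
... | inj₂ refl = n∣lcm[m,n] (lcmUpTo n) (suc n)

primePower∣*-cancel : ∀ {p} → Prime p → ∀ k i m → p ∤ m → p ^ k ∣ p ^ i * m → k ≤ i
primePower∣*-cancel pr zero    i       m p∤m d = z≤n
primePower∣*-cancel {p} pr (suc k) zero m p∤m d =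
  contradiction (subst (p ∣_) (*-identityˡ m) (∣-trans (m∣m*n (p ^ k)) d)) p∤m
primePower∣*-cancel {p} pr (suc k) (suc i) m p∤m d =
  s≤s (primePower∣*-cancel pr k i m p∤m (*-cancelˡ-∣ p {{prime⇒nonZero pr}} (subst (p * p ^ k ∣_) (*-assoc p (p ^ i) m) d)))

^-monoʳ-∣ : ∀ p {m n} → m ≤ n → p ^ m ∣ p ^ n
^-monoʳ-∣ p {m} {n} m≤n = divides (p ^ (n ∸ m))
  (trans (cong (p ^_) (sym (m∸n+n≡m m≤n))) (^-distribˡ-+-* p (n ∸ m) m))

-- With a = p^i a′ and b = p^j b′, the lcm divides p^max(i, j) a′ b′, so k is at most the larger of
-- i and j.
primePower∣lcm : ∀ {p} → Prime p → ∀ k {a b} → 0 < a → 0 < b → p ^ k ∣ lcm a b → p ^ k ∣ a ⊎ p ^ k ∣ b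
primePower∣lcm {p} pr k {a} {b} 0<a 0<b d
  with factorOut p (prime>1 pr) a 0<a | factorOut p (prime>1 pr) b 0<b
... | i , a′ , refl , p∤a′ | j , b′ , refl , p∤b′ with ≤-total i j
...   | inj₁ i≤j = inj₂ (∣m⇒∣m*n b′ (^-monoʳ-∣ p k≤j))
  where
  k≤j : k ≤ j
  k≤j = primePower∣*-cancel pr k j (a′ * b′) ([ p∤a′ , p∤b′ ]′ ∘ euclidsLemma a′ b′ pr)
    (∣-trans d (lcm-least (*-pres-∣ (^-monoʳ-∣ p i≤j) (m∣m*n b′)) (*-monoʳ-∣ (p ^ j) (n∣m*n a′))))
...   | inj₂ j≤i = inj₁ (∣m⇒∣m*n a′ (^-monoʳ-∣ p k≤i))
  where
  k≤i : k ≤ i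
  k≤i = primePower∣*-cancel pr k i (a′ * b′) ([ p∤a′ , p∤b′ ]′ ∘ euclidsLemma a′ b′ pr)
    (∣-trans d (lcm-least (*-monoʳ-∣ (p ^ i) (m∣m*n b′)) (*-pres-∣ (^-monoʳ-∣ p j≤i) (n∣m*n a′))))

lcmUpTo>0 : ∀ n → 0 < lcmUpTo n
lcmUpTo>0 zero    = z<s
lcmUpTo>0 (suc n) = n≢0⇒n>0 λ eq → n>0⇒n≢0 (*-mono-< (lcmUpTo>0 n) (z<s {n}))
  (0∣⇒≡0 (subst (_∣ lcmUpTo n * suc n) eq (lcm-least {lcmUpTo n} (m∣m*n (suc n)) (n∣m*n (lcmUpTo n)))))

primePower∣lcmUpTo : ∀ {p} → Prime p → ∀ k n → 0 < n → p ^ k ∣ lcmUpTo n → p ^ k ≤ n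
primePower∣lcmUpTo {p} pr k (suc n) _ d with primePower∣lcm pr k (lcmUpTo>0 n) z<s d
... | inj₂ d′ = ∣⇒≤ d′
... | inj₁ d′ with n
...   | zero  = ∣⇒≤ d′
...   | suc m = m≤n⇒m≤1+n (primePower∣lcmUpTo pr k (suc m) z<s d′)

-- Takes the place of Legendre's formula: C(n, k) divides lcm(1, ..., n), and a prime power dividing
-- that lcm divides one of the numbers 1, ..., n.
primePower∣nCk⇒≤ : ∀ {p} → Prime p → ∀ e {n k} → 0 < n → k ≤ n → p ^ e ∣ n C k → p ^ e ≤ n
primePower∣nCk⇒≤ {p} pr e {suc n} {zero}  _ _ d =
  ≤-trans (∣⇒≤ (subst (p ^ e ∣_) (nC0≡1 (suc n)) d)) (s≤s z≤n)
primePower∣nCk⇒≤ pr e {suc n} {suc k} _ (s≤s k≤n) d = primePower∣lcmUpTo pr e (suc n) z<s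
  (∣-trans d (∣-trans (divides (suc k) (sym (absorption n k)))
    ([n+1]nCk∣commonMultiple n k k≤n (∣lcmUpTo (suc n)))))

-- Central binomial coefficients

central : ℕ → ℕ
central n = (n + n) C n

nearCentral : ∀ n → suc n * (suc (n + n) C n) ≡ suc (n + n) * central n
nearCentral n = trans (cong (suc n *_) sym-eq) (absorption (n + n) n)
  where
  sym-eq : suc (n + n) C n ≡ suc (n + n) C suc n
  sym-eq = trans (nCk≡nC[n∸k] (m≤n⇒m≤1+n (m≤m+n n n))) (cong (suc (n + n) C_) (m+n∸n≡m (suc n) n))

central-suc : ∀ n → central (suc n) ≡ 2 * (suc (n + n) C n)
central-suc n = *-cancelˡ-≡ _ _ (suc n) (begin
  suc n * (suc (n + suc n) C suc n)      ≡⟨ absorption (n + suc n) n ⟩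
  suc (n + suc n) * ((n + suc n) C n)    ≡⟨ cong (λ m → suc m * (m C n)) (+-suc n n) ⟩
  suc (suc (n + n)) * (suc (n + n) C n)  ≡⟨ lem n (suc (n + n) C n) ⟩
  suc n * (2 * (suc (n + n) C n))        ∎)
  where
  open ≡-Reasoning
  lem : ∀ n x → suc (suc (n + n)) * x ≡ suc n * (2 * x)
  lem = solve-∀

central-recurrence : ∀ n → suc n * central (suc n) ≡ 2 * (suc (n + n) * central n)
central-recurrence n = begin
  suc n * central (suc n)               ≡⟨ cong (suc n *_) (central-suc n) ⟩
  suc n * (2 * (suc (n + n) C n))       ≡⟨ lem (suc n) (suc (n + n) C n) ⟩
  2 * (suc n * (suc (n + n) C n))       ≡⟨ cong (2 *_) (nearCentral n) ⟩
  2 * (suc (n + n) * central n)         ∎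
  where
  open ≡-Reasoning
  lem : ∀ n x → n * (2 * x) ≡ 2 * (n * x)
  lem = solve-∀

-- A step from n to n + 1 multiplies 2 n C(2n, n) by 2 (2n + 1) / n, which is at least 4.
4^n≤2n*central : ∀ n → 4 ^ suc n ≤ (suc n + suc n) * central (suc n)
4^n≤2n*central zero    = ≤-refl
4^n≤2n*central (suc n) = begin
  4 * 4 ^ suc n                          ≤⟨ *-monoʳ-≤ 4 (4^n≤2n*central n) ⟩
  4 * ((m + m) * c)                      ≤⟨ *-monoʳ-≤ 4 (*-monoˡ-≤ c (n≤1+n (m + m))) ⟩
  4 * (suc (m + m) * c)                  ≡⟨ lem₁ (suc (m + m) * c) ⟩
  2 * (2 * (suc (m + m) * c))            ≡⟨ cong (2 *_) (central-recurrence m) ⟨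
  2 * (suc m * central (suc m))          ≡⟨ lem₂ (suc m) (central (suc m)) ⟩
  (suc m + suc m) * central (suc m)      ∎
  where
  open ≤-Reasoning
  m = suc n
  c = central m
  lem₁ : ∀ x → 4 * x ≡ 2 * (2 * x)
  lem₁ = solve-∀
  lem₂ : ∀ m x → 2 * (m * x) ≡ (m + m) * x
  lem₂ = solve-∀

-- The quotient of consecutive terms is 2 (2n + 3) / (n + 2), which is less than 4.
nearCentral≤4^n : ∀ n → suc (n + n) C n ≤ 4 ^ n
nearCentral≤4^n zero    = ≤-refl
nearCentral≤4^n (suc n) = *-cancelˡ-≤ (suc (suc n)) (begin
  suc m * (suc (m + m) C m)              ≡⟨ nearCentral m ⟩
  suc (m + m) * central m                ≡⟨ cong (suc (m + m) *_) (central-suc n) ⟩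
  suc (m + m) * (2 * x)                  ≤⟨ m≤m+n _ (2 * x) ⟩
  suc (m + m) * (2 * x) + 2 * x          ≡⟨ lem m x ⟩
  suc m * (4 * x)                        ≤⟨ *-monoʳ-≤ (suc m) (*-monoʳ-≤ 4 (nearCentral≤4^n n)) ⟩
  suc m * 4 ^ suc n                      ∎)
  where
  open ≤-Reasoning
  m = suc n
  x = suc (n + n) C n
  lem : ∀ m x → suc (m + m) * (2 * x) + 2 * x ≡ suc m * (4 * x)
  lem = solve-∀

prime∤[p+j]Cj : ∀ {p} → Prime p → ∀ j → j < p → p ∤ (p + j) C j
prime∤[p+j]Cj {p} pr zero    _   d = contradiction (∣1⇒≡1 (subst (p ∣_) (nC0≡1 (p + 0)) d)) (≢-sym (<⇒≢ (prime>1 pr)))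
prime∤[p+j]Cj {p} pr (suc j) j<p d
  with euclidsLemma (suc (p + j)) ((p + j) C j) pr
         (subst (p ∣_) (absorption (p + j) j) (∣n⇒∣m*n (suc j) (subst (λ n → p ∣ n C suc j) (+-suc p j) d)))
... | inj₁ d′ = >⇒∤ j<p (∣m+n∣m⇒∣n (subst (p ∣_) (sym (+-suc p j)) d′) ∣-refl)
... | inj₂ d′ = prime∤[p+j]Cj pr j (<-trans (n<1+n j) j<p) d′

prime∤central[p] : ∀ {p} → Prime p → 2 < p → p ∤ central p
prime∤central[p] {suc p} pr 2<p d with euclidsLemma 2 _ pr (subst (suc p ∣_) (central-suc p) d)
... | inj₁ p∣2 = >⇒∤ 2<p p∣2
... | inj₂ d′  = prime∤[p+j]Cj pr p ≤-refl d′

-- Erdős's key observation, for primes p ≤ n < 3p/2 and C(2n, n). Along n = p + r the recurrence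
-- introduces only the factors 2 and 2p + 2r + 1, and p divides neither while 2r + 1 < p.
prime∤central : ∀ {p} → Prime p → 2 < p → ∀ r → r + r < p → p ∤ central (p + r)
prime∤central {p} pr 2<p zero    _   d = prime∤central[p] pr 2<p (subst (λ n → p ∣ central n) (+-identityʳ p) d)
prime∤central {p} pr 2<p (suc r) r<p d
  with euclidsLemma 2 _ pr (subst (p ∣_) (central-recurrence (p + r))
         (∣n⇒∣m*n (suc (p + r)) (subst (λ n → p ∣ central n) (+-suc p r) d)))
... | inj₁ p∣2 = >⇒∤ 2<p p∣2
... | inj₂ d′ with euclidsLemma (suc ((p + r) + (p + r))) _ pr d′
...   | inj₂ d″ = prime∤central pr 2<p r (≤-<-trans (+-mono-≤ (n≤1+n r) (n≤1+n r)) r<p) d″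
...   | inj₁ d″ = >⇒∤ (≤-<-trans (s≤s (+-monoʳ-≤ r (n≤1+n r))) r<p)
                    (∣m+n∣m⇒∣n (subst (p ∣_) (lem p r) d″) (m∣m*n 2))
  where
  lem : ∀ p r → suc ((p + r) + (p + r)) ≡ p * 2 + suc (r + r)
  lem = solve-∀

-- Products of primes and the bound 4^n for primorials

-- The product of the primes in (a, a + l]
primeProduct : ℕ → ℕ → ℕ
primeProduct a zero = 1
primeProduct a (suc l) with prime? (a + suc l)
... | yes _ = (a + suc l) * primeProduct a l
... | no  _ = primeProduct a l

primeProduct-yes : ∀ a l → Prime (a + suc l) → primeProduct a (suc l) ≡ (a + suc l) * primeProduct a l
primeProduct-yes a l pr with prime? (a + suc l)
... | yes _  = refl
... | no ¬pr = contradiction pr ¬pr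

primeProduct-no : ∀ a l → ¬ Prime (a + suc l) → primeProduct a (suc l) ≡ primeProduct a l
primeProduct-no a l ¬pr with prime? (a + suc l)
... | yes pr = contradiction pr ¬pr
... | no _   = refl

primeProduct-+ : ∀ a k l → primeProduct a (k + l) ≡ primeProduct a k * primeProduct (a + k) l
primeProduct-+ a k zero = trans (cong (primeProduct a) (+-identityʳ k)) (sym (*-identityʳ _))
primeProduct-+ a k (suc l) = trans (cong (primeProduct a) (+-suc k l)) helper
  where
  index : a + suc (k + l) ≡ a + k + suc l
  index = trans (cong (a +_) (sym (+-suc k l))) (sym (+-assoc a k (suc l)))
  lem : ∀ n x y → n * (x * y) ≡ x * (n * y)
  lem = solve-∀
  helper : primeProduct a (suc (k + l)) ≡ primeProduct a k * primeProduct (a + k) (suc l)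
  helper with prime? (a + suc (k + l))
  ... | yes pr = trans (cong₂ _*_ index (primeProduct-+ a k l))
                   (trans (lem (a + k + suc l) (primeProduct a k) _)
                     (cong (primeProduct a k *_) (sym (primeProduct-yes (a + k) l (subst Prime index pr)))))
  ... | no ¬pr = trans (primeProduct-+ a k l)
                   (cong (primeProduct a k *_) (sym (primeProduct-no (a + k) l (¬pr ∘ subst Prime (sym index)))))

primeProduct>0 : ∀ a l → 0 < primeProduct a l
primeProduct>0 a zero    = z<s
primeProduct>0 a (suc l) with prime? (a + suc l)
... | yes _ = *-mono-< {0} {a + suc l} (<-≤-trans z<s (m≤n+m (suc l) a)) (primeProduct>0 a l)
... | no  _ = primeProduct>0 a l

prime∤primeProduct : ∀ {p} → Prime p → ∀ a l → a + l < p → p ∤ primeProduct a l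
prime∤primeProduct pr a zero    _   d = contradiction (∣1⇒≡1 d) (≢-sym (<⇒≢ (prime>1 pr)))
prime∤primeProduct pr a (suc l) a+l<p d with prime? (a + suc l)
... | no  _ = prime∤primeProduct pr a l (<-trans (+-monoʳ-< a (n<1+n l)) a+l<p) d
... | yes prₐ with euclidsLemma (a + suc l) _ pr d
...   | inj₁ d′ = >⇒∤ {{prime⇒nonZero prₐ}} a+l<p d′
...   | inj₂ d′ = prime∤primeProduct pr a l (<-trans (+-monoʳ-< a (n<1+n l)) a+l<p) d′

primeProduct-∣ : ∀ a l {m} → (∀ {p} → Prime p → a < p → p ≤ a + l → p ∣ m) → primeProduct a l ∣ m
primeProduct-∣ a zero    _ = 1∣ _
primeProduct-∣ a (suc l) f with prime? (a + suc l)
... | no  _ = primeProduct-∣ a l λ pr a<p p≤ → f pr a<p (≤-trans p≤ (+-monoʳ-≤ a (n≤1+n l)))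
... | yes pr = coprime-*-∣
  (prime∤⇒coprime pr (prime∤primeProduct pr a l (+-monoʳ-< a (n<1+n l))))
  (f pr (m<m+n a z<s) ≤-refl)
  (primeProduct-∣ a l λ pr a<p p≤ → f pr a<p (≤-trans p≤ (+-monoʳ-≤ a (n≤1+n l))))

-- Such a prime divides (a + b)! but neither a! nor b!. Without factorials: by `absorption`, either
-- p = a + b is the new factor or p divides the coefficient for a - 1, and p does not divide a.
prime∣[a+b]Ca : ∀ {p} → Prime p → ∀ a b → a < p → b < p → p ≤ a + b → p ∣ (a + b) C a
prime∣[a+b]Ca pr zero    b _   b<p p≤b = contradiction b<p (≤⇒≯ p≤b)
prime∣[a+b]Ca {p} pr (suc a) b a<p b<p p≤ =
  [ (λ d → contradiction d (>⇒∤ a<p)) , id ]′ (euclidsLemma (suc a) _ pr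
    (subst (p ∣_) (sym (absorption (a + b) a)) p∣rhs))
  where
  p∣rhs : p ∣ suc (a + b) * ((a + b) C a)
  p∣rhs with m≤n⇒m<n∨m≡n p≤
  ... | inj₁ (s≤s p≤a+b) = ∣n⇒∣m*n (suc (a + b)) (prime∣[a+b]Ca pr a b (<-trans (n<1+n a) a<p) b<p p≤a+b)
  ... | inj₂ refl        = m∣m*n _

primorial : ℕ → ℕ
primorial = primeProduct 0

halve : ∀ n → (∃ λ m → n ≡ m + m) ⊎ (∃ λ m → n ≡ suc (m + m))
halve zero = inj₁ (0 , refl)
halve (suc n) with halve n
... | inj₁ (m , eq) = inj₂ (m , cong suc eq)
... | inj₂ (m , eq) = inj₁ (suc m , trans (cong suc eq) (cong suc (sym (+-suc m m))))

-- An even n > 2 is not prime, so n - 1 gives the same product. For n = 2m + 1 the primes in (m + 1,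
-- 2m + 1] all divide C(2m+1, m) ≤ 4^m, and induction bounds the rest by 4^(m+1).
primorial≤4^n : ∀ n → primorial n ≤ 4 ^ n
primorial≤4^n = <-rec _ go
  where
  go : ∀ n → (∀ {m} → m < n → primorial m ≤ 4 ^ m) → primorial n ≤ 4 ^ n
  go n rec with halve n
  ... | inj₁ (zero , refl) = ≤-refl
  ... | inj₁ (suc zero , refl) = toWitness {a? = 2 ≤? 16} _
  ... | inj₁ (m@(suc (suc l)) , refl) = begin
    primorial (suc (suc l + m))   ≡⟨ primeProduct-no 0 (suc l + m) ¬prime ⟩
    primorial (suc l + m)         ≤⟨ rec ≤-refl ⟩
    4 ^ (suc l + m)               ≤⟨ ^-monoʳ-≤ 4 (n≤1+n (suc l + m)) ⟩
    4 ^ (m + m)                   ∎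
    where
    open ≤-Reasoning
    lem : ∀ l → suc (suc l) + suc (suc l) ≡ suc (suc l) * 2
    lem = solve-∀
    ¬prime : ¬ Prime (m + m)
    ¬prime pr with prime⇒irreducible pr (divides m (lem l))
    ... | inj₂ 2≡ = contradiction 2≡ (<⇒≢ (s<s (s<s (<-≤-trans z<s (m≤n+m m l)))))
  ... | inj₂ (zero , refl) = toWitness {a? = 1 ≤? 4} _
  ... | inj₂ (m@(suc l) , refl) = begin
    primorial (suc m + m)                     ≡⟨ primeProduct-+ 0 (suc m) m ⟩
    primorial (suc m) * primeProduct (suc m) m ≤⟨ *-mono-≤ (rec (s<s (m<m+n m z<s))) upper ⟩
    4 ^ suc m * 4 ^ m                         ≡⟨ ^-distribˡ-+-* 4 (suc m) m ⟨
    4 ^ (suc m + m)                           ∎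
    where
    open ≤-Reasoning
    upper : primeProduct (suc m) m ≤ 4 ^ m
    upper = ≤-trans (∣⇒≤ {{>-nonZero (nCk>0 {suc (m + m)} (m≤n⇒m≤1+n (m≤m+n m m)))}}
      (primeProduct-∣ (suc m) m λ {p} pr m<p p≤ →
        subst (λ n → p ∣ n C m) (+-suc m m)
          (prime∣[a+b]Ca pr m (suc m) (<-trans (n<1+n m) m<p) m<p (subst (p ≤_) (sym (+-suc m m)) p≤))))
      (nearCentral≤4^n m)

-- Erdős's proof of Bertrand's postulate

-- X = a b with a ≤ B, where b collects the prime factors of X above x.
SmoothPart≤ : ℕ → ℕ → ℕ → Set
SmoothPart≤ X x B = ∃₂ λ a b → X ≡ a * b × a ≤ B × (∀ {q} → Prime q → q ≤ x → q ∤ b)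

smoothPart-0 : ∀ X → SmoothPart≤ X 0 1
smoothPart-0 X = 1 , X , sym (*-identityˡ X) , ≤-refl , λ pr q≤0 → contradiction (<-trans z<s (prime>1 pr)) (≤⇒≯ q≤0)

-- Vacuous for composite p, which lets the lemmas below move x through all integers in turn.
PrimePowersAt≤ : ℕ → ℕ → ℕ → Set
PrimePowersAt≤ X p K = Prime p → ∀ e → p ^ e ∣ X → p ^ e ≤ K

∤⇒primePowers≤1 : ∀ {X p} → (Prime p → p ∤ X) → PrimePowersAt≤ X p 1
∤⇒primePowers≤1 p∤X pr zero    _ = ≤-refl
∤⇒primePowers≤1 {p = p} p∤X pr (suc e) d = contradiction (∣-trans (m∣m*n (p ^ e)) d) (p∤X pr)

module _ {X : ℕ} (0<X : 0 < X) where

  -- If x + 1 is prime, its full power in b moves to a, at a cost of at most K; otherwise only the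
  -- bound is relaxed.
  smoothPart-suc : ∀ {x B K} → 0 < K → PrimePowersAt≤ X (suc x) K → SmoothPart≤ X x B → SmoothPart≤ X (suc x) (B * K)
  smoothPart-suc {x} {B} {K} 0<K bound (a , b , X≡ab , a≤B , rough) with prime? (suc x)
  ... | no ¬pr = a , b , X≡ab , ≤-trans a≤B (m≤m*n B K {{>-nonZero 0<K}}) , rough′
    where
    rough′ : ∀ {q} → Prime q → q ≤ suc x → q ∤ b
    rough′ pr q≤ with m≤n⇒m<n∨m≡n q≤
    ... | inj₁ q<   = rough pr (≤-pred q<)
    ... | inj₂ refl = contradiction pr ¬pr
  ... | yes prₓ with factorOut (suc x) (prime>1 prₓ) b
                       (n≢0⇒n>0 λ b≡0 → n>0⇒n≢0 0<X (trans X≡ab (trans (cong (a *_) b≡0) (*-zeroʳ a))))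
  ...   | e , m , b≡pᵉm , p∤m = a * suc x ^ e , m , X≡apᵉm , *-mono-≤ a≤B (bound prₓ e pᵉ∣X) , rough′
    where
    X≡apᵉm : X ≡ a * suc x ^ e * m
    X≡apᵉm = trans X≡ab (trans (cong (a *_) b≡pᵉm) (sym (*-assoc a _ m)))
    pᵉ∣X : suc x ^ e ∣ X
    pᵉ∣X = subst (suc x ^ e ∣_) (sym X≡apᵉm) (∣m⇒∣m*n m (n∣m*n a))
    rough′ : ∀ {q} → Prime q → q ≤ suc x → q ∤ m
    rough′ pr q≤ q∣m with m≤n⇒m<n∨m≡n q≤
    ... | inj₁ q<   = rough pr (≤-pred q<) (subst (_ ∣_) (sym b≡pᵉm) (∣n⇒∣m*n (suc x ^ e) q∣m))
    ... | inj₂ refl = p∤m q∣m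

  smoothPart-^ : ∀ {x B K} → 0 < K → ∀ l → (∀ {p} → x < p → p ≤ x + l → PrimePowersAt≤ X p K) →
                 SmoothPart≤ X x B → SmoothPart≤ X (x + l) (B * K ^ l)
  smoothPart-^ {x} {B} {K} 0<K zero bound s = subst₂ (SmoothPart≤ X) (sym (+-identityʳ x)) (sym (*-identityʳ B)) s
  smoothPart-^ {x} {B} {K} 0<K (suc l) bound s =
    subst₂ (SmoothPart≤ X) (sym (+-suc x l)) (lem B K (K ^ l))
      (smoothPart-suc 0<K (bound (s≤s (m≤m+n x l)) (≤-reflexive (sym (+-suc x l))))
        (smoothPart-^ 0<K l (λ x<p p≤ → bound x<p (≤-trans p≤ (+-monoʳ-≤ x (n≤1+n l)))) s))
    where
    lem : ∀ b c d → b * d * c ≡ b * (c * d)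
    lem = solve-∀

  smoothPart-skip : ∀ {x y B} → x ≤ y → (∀ {p} → Prime p → x < p → p ≤ y → p ∤ X) →
                    SmoothPart≤ X x B → SmoothPart≤ X y B
  smoothPart-skip {x} {y} {B} x≤y p∤X s with m≤n⇒∃[o]m+o≡n x≤y
  ... | l , refl = subst (SmoothPart≤ X (x + l)) (trans (cong (B *_) (^-zeroˡ l)) (*-identityʳ B))
    (smoothPart-^ z<s l (λ x<p p≤ → ∤⇒primePowers≤1 λ pr → p∤X pr x<p p≤) s)

  module _ {M : ℕ} (powers≤M : ∀ {p} → PrimePowersAt≤ X p M) where

    -- An exponent of two or more would give p² ≤ M.
    large⇒primePowers≤ : ∀ {p} → M < p * p → PrimePowersAt≤ X p p
    large⇒primePowers≤ {p} M<p² pr zero    d = <⇒≤ (prime>1 pr)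
    large⇒primePowers≤ {p} M<p² pr (suc zero) d = ≤-reflexive (*-identityʳ p)
    large⇒primePowers≤ {p} M<p² pr (suc (suc e)) d = contradiction M<p²
      (≤⇒≯ (≤-trans (*-monoʳ-≤ p (m≤m*n p (p ^ e) {{m^n≢0 p e {{prime⇒nonZero pr}}}})) (powers≤M pr (suc (suc e)) d)))

    smoothPart-primeProduct : ∀ {x B} → M < suc x * suc x → ∀ l →
                              SmoothPart≤ X x B → SmoothPart≤ X (x + l) (B * primeProduct x l)
    smoothPart-primeProduct {x} {B} M<x² zero s = subst₂ (SmoothPart≤ X) (sym (+-identityʳ x)) (sym (*-identityʳ B)) s
    smoothPart-primeProduct {x} {B} M<x² (suc l) s with prime? (x + suc l) | smoothPart-primeProduct M<x² l s
    ... | no ¬pr | s′ = subst₂ (SmoothPart≤ X) (sym (+-suc x l)) (*-identityʳ _)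
      (smoothPart-suc z<s (∤⇒primePowers≤1 λ pr → contradiction (subst Prime (sym (+-suc x l)) pr) ¬pr) s′)
    ... | yes _  | s′ = subst₂ (SmoothPart≤ X) (sym (+-suc x l))
      (trans (lem B (primeProduct x l) (suc (x + l))) (cong (λ n → B * (n * primeProduct x l)) (sym (+-suc x l))))
      (smoothPart-suc z<s (large⇒primePowers≤ (<-≤-trans M<x² (*-mono-≤ (s≤s (m≤m+n x l)) (s≤s (m≤m+n x l))))) s′)
      where
      lem : ∀ a b c → a * b * c ≡ a * (c * b)
      lem = solve-∀

    -- All prime factors of X are at most M, so at x = M nothing but 1 is left for b.
    smoothPart-all : ∀ {B} → SmoothPart≤ X M B → X ≤ B
    smoothPart-all {B} (a , zero , X≡ab , _) = contradiction (trans X≡ab (*-zeroʳ a)) (n>0⇒n≢0 0<X)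
    smoothPart-all {B} (a , suc zero , X≡ab , a≤B , _) = ≤-trans (≤-reflexive (trans X≡ab (*-identityʳ a))) a≤B
    smoothPart-all {B} (a , b@(suc (suc _)) , X≡ab , _ , rough) with primeDivisor b (s<s z<s)
    ... | q , pr , q∣b = contradiction q∣b (rough pr q≤M)
      where
      q≤M : q ≤ M
      q≤M = subst (_≤ M) (*-identityʳ q)
        (powers≤M pr 1 (subst₂ _∣_ (sym (*-identityʳ q)) (sym X≡ab) (∣n⇒∣m*n a q∣b)))

-- Square roots against logarithms

n<2^n : ∀ n → n < 2 ^ n
n<2^n zero    = z<s
n<2^n (suc n) = begin-strict
  suc n          ≤⟨ n<2^n n ⟩
  2 ^ n          <⟨ m<m*n (2 ^ n) 2 {{m^n≢0 2 n}} (s<s z<s) ⟩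
  2 ^ n * 2      ≡⟨ *-comm (2 ^ n) 2 ⟩
  2 ^ suc n      ∎
  where open ≤-Reasoning

-- After substituting r = a + w and expanding, the comparison splits into its constant, linear and
-- quadratic parts in j and w.
quadratic-< : ∀ {a c q r} j w → r ≡ a + w → 2 + r ≡ q + w → 2 * (c * (q * 3)) < a * a →
              6 * c * w + 6 * q * j ≤ (a + a) * w → 6 * j ≤ w → 2 * (c + j) * ((2 + r) * 3) < r * r
quadratic-< {a} {c} {q} {r} j w r≡ 2+r≡ constant linear square = begin-strict
  2 * (c + j) * ((2 + r) * 3)                                 ≡⟨ cong (λ x → 2 * (c + j) * (x * 3)) 2+r≡ ⟩
  2 * (c + j) * ((q + w) * 3)                                 ≡⟨ lhs c q j w ⟩
  2 * (c * (q * 3)) + (6 * c * w + 6 * q * j) + 6 * j * w     <⟨ +-mono-<-≤ (+-mono-<-≤ constant linear) (*-monoˡ-≤ w square) ⟩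
  a * a + (a + a) * w + w * w                                 ≡⟨ rhs a w ⟩
  (a + w) * (a + w)                                           ≡⟨ cong₂ _*_ r≡ r≡ ⟨
  r * r                                                       ∎
  where
  open ≤-Reasoning
  lhs : ∀ c q j w → 2 * (c + j) * ((q + w) * 3) ≡ 2 * (c * (q * 3)) + (6 * c * w + 6 * q * j) + 6 * j * w
  lhs = solve-∀
  rhs : ∀ a w → a * a + (a + a) * w + w * w ≡ (a + w) * (a + w)
  rhs = solve-∀

-- The exponent 7 + (r - 47) / 16 bounds log₂ (r + 1) for r ≥ 47.
sqrtDominatesLog : ∀ r → 47 ≤ r → ∃ λ e → suc r ≤ 2 ^ e × 2 * e * ((2 + r) * 3) < r * r
sqrtDominatesLog r 47≤r = 7 + j , r<2^e ,
  -- At r = 47 the claim is 2 · 7 · 49 · 3 = 2058 < 2209 = 47². As 47 + 1 = 3 · 16, a step of 16 in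
  -- r pays for one unit of e: r + 1 ≤ 16 (4 + j) ≤ 2^(7+j).
  quadratic-< {47} {7} {49} j w (sym 47+w≡r) (cong (2 +_) (sym 47+w≡r)) (toWitness {a? = 2058 <? 2209} _) linear
    (≤-trans (≤-reflexive (*-comm 6 j)) (≤-trans (*-monoʳ-≤ j (toWitness {a? = 6 ≤? 16} _)) 16j≤w))
  where
  open ≤-Reasoning
  w = r ∸ 47
  j = w / 16

  47+w≡r : 47 + w ≡ r
  47+w≡r = m+[n∸m]≡n 47≤r

  16j≤w : j * 16 ≤ w
  16j≤w = m/n*n≤m w 16

  linear : 42 * w + 294 * j ≤ 94 * w
  linear = begin
    42 * w + 294 * j        ≤⟨ +-monoʳ-≤ (42 * w) (*-monoˡ-≤ j (toWitness {a? = 294 ≤? 52 * 16} _)) ⟩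
    42 * w + 52 * 16 * j    ≡⟨ cong (42 * w +_) (trans (*-assoc 52 16 j) (cong (52 *_) (*-comm 16 j))) ⟩
    42 * w + 52 * (j * 16)  ≤⟨ +-monoʳ-≤ (42 * w) (*-monoʳ-≤ 52 16j≤w) ⟩
    42 * w + 52 * w         ≡⟨ *-distribʳ-+ w 42 52 ⟨
    94 * w                  ∎

  r<2^e : suc r ≤ 2 ^ (7 + j)
  r<2^e = begin
    suc r                       ≡⟨ cong suc 47+w≡r ⟨
    48 + w                      ≡⟨ cong (48 +_) (m≡m%n+[m/n]*n w 16) ⟩
    48 + (w % 16 + j * 16)      ≤⟨ +-monoʳ-≤ 48 (+-monoˡ-≤ (j * 16) (<⇒≤ (m%n<n w 16))) ⟩
    (4 + j) * 16                ≤⟨ *-monoˡ-≤ 16 (n<2^n (3 + j)) ⟩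
    2 ^ (3 + j) * 2 ^ 4         ≡⟨ ^-distribˡ-+-* 2 (3 + j) 4 ⟨
    2 ^ (3 + j + 4)             ≡⟨ cong (2 ^_) (+-comm (3 + j) 4) ⟩
    2 ^ (7 + j)                 ∎

-- With r = ⌊√(2n)⌋ and t = ⌊2n/3⌋, the primes up to r contribute at most 2n each to C(2n, n), those
-- in (r, t] together at most 4^t, and n + 1 at most n + 1; no others occur. Thus 4^n ≤ (2n)^(r+2)
-- 4^t, which `sqrtDominatesLog` refutes for r ≥ 47.
¬noPrimeBetween : ∀ n → 47 ≤ ⌊√ n + n ⌋ → ¬ (∀ {p} → Prime p → suc n < p → p < n + n → ⊥)
¬noPrimeBetween zero () _
¬noPrimeBetween n@(suc n-1) 47≤r noPrime = <-irrefl refl (begin-strict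
  M                     ≤⟨ M≤ ⟩
  2 * e * ((2 + r) * 3) <⟨ proj₂ (proj₂ log) ⟩
  r * r                 ≤⟨ √-lower M ⟩
  M                     ∎)
  where
  open ≤-Reasoning
  M = n + n
  r = ⌊√ M ⌋
  t = M / 3
  X = central n
  log = sqrtDominatesLog r 47≤r
  e = proj₁ log

  0<X : 0 < X
  0<X = nCk>0 {n + n} (m≤m+n n n)

  powers≤M : ∀ {p} → PrimePowersAt≤ X p M
  powers≤M pr e d = primePower∣nCk⇒≤ pr e z<s (m≤m+n n n) d

  3r≤M : r * 3 ≤ M
  3r≤M = ≤-trans (*-monoʳ-≤ r (≤-trans (s≤s (s≤s (s≤s z≤n))) 47≤r)) (√-lower M)

  r≤t : r ≤ t
  r≤t = subst (_≤ t) (m*n/n≡m r 3) (/-monoˡ-≤ 3 3r≤M)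

  M<3p : ∀ {p} → t < p → M < p * 3
  M<3p {p} t<p = begin-strict
    M               ≡⟨ m≡m%n+[m/n]*n M 3 ⟩
    M % 3 + t * 3   <⟨ +-monoˡ-< (t * 3) (m%n<n M 3) ⟩
    suc t * 3       ≤⟨ *-monoˡ-≤ 3 t<p ⟩
    p * 3           ∎

  t≤n : t ≤ n
  t≤n = ≤-pred (m<n*o⇒m/o<n {M} {suc n} {3} (subst (M <_) (sym (lem n)) (m<m+n M z<s)))
    where
    lem : ∀ n → suc n * 3 ≡ n + n + suc (2 + n)
    lem = solve-∀

  47<p : ∀ {p} → t < p → 47 < p
  47<p t<p = ≤-<-trans (≤-trans 47≤r r≤t) t<p

  middle∤ : ∀ {p} → Prime p → t < p → p ≤ n → p ∤ X
  middle∤ {p} pr t<p p≤n with m≤n⇒∃[o]m+o≡n p≤n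
  ... | o , eq = subst (λ m → p ∤ central m) eq
        (prime∤central pr (<-trans (s<s (s<s z<s)) (47<p t<p)) o
          (+-cancelˡ-< (p * 2) (o + o) p (begin-strict
            p * 2 + (o + o)   ≡⟨ lem₁ p o ⟩
            (p + o) + (p + o) ≡⟨ cong₂ _+_ eq eq ⟩
            M                 <⟨ M<3p t<p ⟩
            p * 3             ≡⟨ lem₂ p ⟩
            p * 2 + p         ∎)))
    where
    lem₁ : ∀ p o → p * 2 + (o + o) ≡ (p + o) + (p + o)
    lem₁ = solve-∀
    lem₂ : ∀ p → p * 3 ≡ p * 2 + p
    lem₂ = solve-∀

  2∣M : 2 ∣ M
  2∣M = divides n (trans (cong (n +_) (sym (+-identityʳ n))) (*-comm 2 n))

  upper∤ : ∀ {p} → Prime p → suc n < p → p ≤ M → p ∤ X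
  upper∤ pr n<p p≤M _ with m≤n⇒m<n∨m≡n p≤M
  ... | inj₁ p<M  = noPrime pr n<p p<M
  ... | inj₂ refl with prime⇒irreducible pr 2∣M
  ...   | inj₂ 2≡M = contradiction 2≡M (<⇒≢ (≤-<-trans (s≤s (s≤s z≤n)) n<p))

  l : ℕ
  l = proj₁ (m≤n⇒∃[o]m+o≡n r≤t)

  r+l≡t : r + l ≡ t
  r+l≡t = proj₂ (m≤n⇒∃[o]m+o≡n r≤t)

  X≤product : X ≤ 1 * M ^ r * primeProduct r l * suc n
  -- To be read from the inside out: the smoothness bound climbs through 0, r, t, n, n + 1 and M.
  X≤product = smoothPart-all 0<X powers≤M
    (smoothPart-skip 0<X (+-monoˡ-≤ n (s≤s (z≤n {n-1}))) upper∤
      -- `noPrime` does not exclude n + 1; (n + 1)² > 2n limits it to a single occurrence.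
      (smoothPart-suc 0<X z<s (large⇒primePowers≤ 0<X powers≤M M<[n+1]²)
        (smoothPart-skip 0<X t≤n middle∤
          (subst (λ x → SmoothPart≤ X x (1 * M ^ r * primeProduct r l)) r+l≡t
            (smoothPart-primeProduct 0<X powers≤M (√-upper M) l
              (smoothPart-^ 0<X z<s r (λ _ _ → powers≤M) (smoothPart-0 X)))))))
    where
    lem : ∀ n → suc n * suc n ≡ n + n + suc (n * n)
    lem = solve-∀
    M<[n+1]² : M < suc n * suc n
    M<[n+1]² = subst (M <_) (sym (lem n)) (m<m+n M z<s)

  middleProduct≤ : primeProduct r l ≤ 4 ^ t
  middleProduct≤ = begin
    primeProduct r l                ≤⟨ m≤n*m (primeProduct r l) (primorial r) {{>-nonZero (primeProduct>0 0 r)}} ⟩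
    primorial r * primeProduct r l  ≡⟨ primeProduct-+ 0 r l ⟨
    primorial (r + l)               ≤⟨ primorial≤4^n (r + l) ⟩
    4 ^ (r + l)                     ≡⟨ cong (4 ^_) r+l≡t ⟩
    4 ^ t                           ∎

  4^n≤ : 4 ^ n ≤ M ^ (2 + r) * 4 ^ t
  4^n≤ = begin
    4 ^ n                                       ≤⟨ 4^n≤2n*central n-1 ⟩
    M * X                                       ≤⟨ *-monoʳ-≤ M X≤product ⟩
    -- Rounding n + 1 up to M, together with the leading M, raises the exponent r to 2 + r.
    M * (1 * M ^ r * primeProduct r l * suc n)  ≤⟨ *-monoʳ-≤ M (*-mono-≤ (*-monoʳ-≤ (1 * M ^ r) middleProduct≤) (+-monoˡ-≤ n (s≤s (z≤n {n-1})))) ⟩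
    M * (1 * M ^ r * 4 ^ t * M)                 ≡⟨ lem M (M ^ r) (4 ^ t) ⟩
    M ^ (2 + r) * 4 ^ t                         ∎
    where
    lem : ∀ m x y → m * (1 * x * y * m) ≡ m * (m * x) * y
    lem = solve-∀

  -- Cubing removes the rounding in t, since 3 t ≤ M.
  4^n≤′ : 4 ^ n ≤ M ^ ((2 + r) * 3)
  4^n≤′ = *-cancelʳ-≤ _ _ (4 ^ M) {{m^n≢0 4 M}} (begin
    4 ^ n * 4 ^ M                    ≡⟨ ^-distribˡ-+-* 4 n M ⟨
    4 ^ (n + M)                      ≡⟨ cong (4 ^_) (lem n) ⟩
    4 ^ (n * 3)                      ≡⟨ ^-*-assoc 4 n 3 ⟨
    (4 ^ n) ^ 3                      ≤⟨ ^-monoˡ-≤ 3 4^n≤ ⟩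
    (M ^ (2 + r) * 4 ^ t) ^ 3        ≡⟨ ^-distribʳ-* 3 (M ^ (2 + r)) (4 ^ t) ⟩
    (M ^ (2 + r)) ^ 3 * (4 ^ t) ^ 3  ≡⟨ cong₂ _*_ (^-*-assoc M (2 + r) 3) (^-*-assoc 4 t 3) ⟩
    M ^ ((2 + r) * 3) * 4 ^ (t * 3)  ≤⟨ *-monoʳ-≤ (M ^ ((2 + r) * 3)) (^-monoʳ-≤ 4 (m/n*n≤m M 3)) ⟩
    M ^ ((2 + r) * 3) * 4 ^ M        ∎)
    where
    lem : ∀ n → n + (n + n) ≡ n * 3
    lem = solve-∀

  M≤4^e : M ≤ 2 ^ (2 * e)
  M≤4^e = begin
    M               ≤⟨ <⇒≤ (√-upper M) ⟩
    suc r * suc r   ≤⟨ *-mono-≤ (proj₁ (proj₂ log)) (proj₁ (proj₂ log)) ⟩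
    2 ^ e * 2 ^ e   ≡⟨ ^-distribˡ-+-* 2 e e ⟨
    2 ^ (e + e)     ≡⟨ cong (λ m → 2 ^ (e + m)) (+-identityʳ e) ⟨
    2 ^ (2 * e)     ∎

  M≤ : M ≤ 2 * e * ((2 + r) * 3)
  -- The logarithm to base 2 of 4^n ≤ M^(3 (r + 2)), taken by comparing exponents of 2.
  M≤ = ≮⇒≥ λ <M → <-irrefl refl (begin-strict
    4 ^ n                             ≤⟨ 4^n≤′ ⟩
    M ^ ((2 + r) * 3)                 ≤⟨ ^-monoˡ-≤ ((2 + r) * 3) M≤4^e ⟩
    (2 ^ (2 * e)) ^ ((2 + r) * 3)     ≡⟨ ^-*-assoc 2 (2 * e) ((2 + r) * 3) ⟩
    2 ^ (2 * e * ((2 + r) * 3))       <⟨ ^-monoʳ-< 2 (s<s z<s) <M ⟩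
    2 ^ M                             ≡⟨ cong (λ m → 2 ^ (n + m)) (+-identityʳ n) ⟨
    2 ^ (2 * n)                       ≡⟨ ^-*-assoc 2 2 n ⟨
    4 ^ n                             ∎)

-- Bertrand's postulate, with a chain of primes for small n

PrimeBetween : ℕ → Set
PrimeBetween n = ∃ λ p → Prime p × suc n < p × p < n + n

-- If p does not exceed n + 1, then q < 2p - 2 ≤ 2n, so the upper bound passes on to the next link q
-- of the chain.
bertrand-from : ∀ {n} p q → Prime p → q + 2 < p + p → (q < n + n → PrimeBetween n) → p < n + n → PrimeBetween n
bertrand-from {n} p q pr q+2<2p next p<2n with suc n <? p
... | yes n<p = p , pr , n<p , p<2n
... | no  n≮p = next (+-cancelʳ-< 2 q (n + n) (<-≤-trans q+2<2p (begin
  p + p             ≤⟨ +-mono-≤ (≮⇒≥ n≮p) (≮⇒≥ n≮p) ⟩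
  suc n + suc n     ≡⟨ cong suc (+-suc n n) ⟩
  2 + (n + n)       ≡⟨ +-comm 2 (n + n) ⟩
  n + n + 2         ∎)))
  where open ≤-Reasoning

-- A bounded search turns the refutation into a witness. Since 2208 = 47² - 1, the hypothesis says
-- that ⌊√(2n)⌋ ≥ 47.
bertrand-large : ∀ n → 2208 < n + n → PrimeBetween n
bertrand-large n 2208<2n with anyUpTo? (λ p → prime? p ×-dec suc n <? p) (n + n)
... | yes (p , p<2n , pr , n<p) = p , pr , n<p , p<2n
... | no  ∄ = contradiction (λ {p} pr n<p p<2n → ∄ (p , p<2n , pr , n<p)) (¬noPrimeBetween n 47≤√)
  where
  47≤√ : 47 ≤ ⌊√ n + n ⌋
  47≤√ = ≮⇒≥ λ √<47 → <⇒≱ (<-≤-trans (√-upper (n + n)) (*-mono-≤ √<47 √<47)) 2208<2n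

bertrand : ∀ n → 3 ≤ n → PrimeBetween n
bertrand n 3≤n =
  (bertrand-from 5 7 (from-yes (prime? 5)) (from-yes (9 <? 10)) $
   bertrand-from 7 11 (from-yes (prime? 7)) (from-yes (13 <? 14)) $
   bertrand-from 11 17 (from-yes (prime? 11)) (from-yes (19 <? 22)) $
   bertrand-from 17 31 (from-yes (prime? 17)) (from-yes (33 <? 34)) $
   bertrand-from 31 59 (from-yes (prime? 31)) (from-yes (61 <? 62)) $
   bertrand-from 59 113 (from-yes (prime? 59)) (from-yes (115 <? 118)) $
   bertrand-from 113 223 (from-yes (prime? 113)) (from-yes (225 <? 226)) $
   bertrand-from 223 443 (from-yes (prime? 223)) (from-yes (445 <? 446)) $
   bertrand-from 443 883 (from-yes (prime? 443)) (from-yes (885 <? 886)) $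
   bertrand-from 883 1759 (from-yes (prime? 883)) (from-yes (1761 <? 1766)) $
   -- The last link leads not to a prime but to 2208, the threshold of `bertrand-large`.
   bertrand-from 1759 2208 (from-yes (prime? 1759)) (from-yes (2210 <? 3518)) $
   bertrand-large n)
  (+-mono-≤ 3≤n 3≤n)

-- The lower bound for h(N)

3≤h : ∀ {N} → 4 ≤ N → 3 ≤ h N
3≤h {N} 4≤N = h-upper N set (unique , range , from-yes (sidon? set))
  where
  set : List ℤ
  set = ℤ.+ 1 ∷ ℤ.+ 2 ∷ ℤ.+ 4 ∷ []
  unique : Unique set
  unique = from-yes (allPairs? (λ x y → ¬? (x ℤ.≟ y)) set)
  range : All (λ a → ℤ.+ 1 ℤ.≤ a × a ℤ.≤ ℤ.+ N) set
  range = All.map (λ (1≤a , a≤4) → 1≤a , ℤ.≤-trans a≤4 (ℤ.+≤+ 4≤N))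
    (from-yes (all? (λ a → (ℤ.+ 1 ℤ.≤? a) ×-dec (a ℤ.≤? ℤ.+ 4)) set))

mainTheorem11 : ∀ (N : ℕ) → 5 ≤ N → h N > (⌊√ N ⌋ + 1) / 2
mainTheorem11 N 5≤N = byCases ((⌊√ N ⌋ + 1) / 2) (m/n*n≤m (⌊√ N ⌋ + 1) 2)
  where
  byCases : ∀ m → m * 2 ≤ ⌊√ N ⌋ + 1 → m < h N
  byCases m 2m≤√N+1 with 3 ≤? m
  ... | no  m<3 = ≤-trans (≰⇒> m<3) (3≤h (<⇒≤ 5≤N))
  ... | yes 3≤m with bertrand m 3≤m
  ...   | p , pr , m+1<p , p<2m = ≤-trans (pred-mono-≤ m+1<p) (Ruzsa.ruzsa pr (begin
    p * pred p        ≤⟨ *-mono-≤ p≤√N (≤-trans (pred[n]≤n {p}) p≤√N) ⟩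
    ⌊√ N ⌋ * ⌊√ N ⌋   ≤⟨ √-lower N ⟩
    N                 ∎))
    where
    open ≤-Reasoning
    p≤√N : p ≤ ⌊√ N ⌋
    p≤√N = ≤-pred (begin
      suc p           ≤⟨ p<2m ⟩
      m + m           ≡⟨ cong (λ n → m + n) (+-identityʳ m) ⟨
      2 * m           ≡⟨ *-comm 2 m ⟩
      m * 2           ≤⟨ 2m≤√N+1 ⟩
      ⌊√ N ⌋ + 1      ≡⟨ +-comm ⌊√ N ⌋ 1 ⟩
      suc ⌊√ N ⌋      ∎)
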